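{- For any integer $c\ge0$, the operad ${\mathbf{Hi}_{\underline{c}}}^!$ is isomorphic to the quotient of the free operad generated by the set $\{\mathsf{K}^\star_0,\dots,\mathsf{K}^\star_c\}$ of symbols of arity $2$ by the operad ideal generated by $$\mathsf{K}^\star_b\circ_1\mathsf{K}^\star_a-\mathsf{K}^\star_a\circ_2\mathsf{K}^\star_b,\qquad b\in\{0,\dots,c\},\ a\in\{0,\dots,b\}.$$
   Context: $\mathbb{N}=\{0,1,2,\dots\}$ and $\mathbb{K}$ is a field of characteristic zero. All operads are nonsymmetric operads in $\mathbb{K}$-vector spaces. Fix $c\ge0$. For a word $w$ on $\mathbb{N}$, $\ell(w)$ is its length, $w(i)$ its $i$-th letter, $\epsilon$ the empty word, $|w|:=\ell(w)+1$. $\mathsf{Cl}_{\underline{c}}$ is the set of all words on $\{0,\dots,c\}$, and $\mathsf{Hi}_{\underline{c}}$ is its subset of weakly increasing words. $\mathbf{Cl}_{\underline{c}}$ is the operad with basis $\{\mathsf{E}_w:w\in\mathsf{Cl}_{\underline{c}}\}$, $\mathsf{E}_w$ of arity $|w|$, with $\mathsf{E}_u\circ_i\mathsf{E}_v:=\mathsf{E}_{u(1)\cdots u(i-1)\,v\,u(i)\cdots u(\ell(u))}$ for $1\le i\le|u|$, and unit $\mathsf{E}_\epsilon$. For words of the same length, $u\preccurlyeq v$ iff $u(j)\le v(j)$ for all $j$. The $\mathsf{F}$-basis of $\mathbf{Cl}_{\underline{c}}$ is determined by $\mathsf{E}_w=\sum_{w'\in\mathsf{Cl}_{\underline{c}},\,w\preccurlyeq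 w'}\mathsf{F}_{w'}$ (Möbius inversion). The span of $\{\mathsf{F}_w:w\in\mathsf{Cl}_{\underline{c}}\setminus\mathsf{Hi}_{\underline{c}}\}$ is an operad ideal, and $\mathbf{Hi}_{\underline{c}}$ is the quotient operad; for $w\in\mathsf{Hi}_{\underline{c}}$, $\mathsf{E}_w\in\mathbf{Hi}_{\underline{c}}$ denotes the image of $\mathsf{E}_w$. The operad $\mathbf{Hi}_{\underline{c}}$ is binary and quadratic: it is the quotient of the free operad on the arity-$2$ generators $\mathsf{E}_0,\dots,\mathsf{E}_c$ by the ideal generated by the space $R$ (in arity $3$ of the free operad) spanned by $\mathsf{E}_a\circ_1\mathsf{E}_b-\mathsf{E}_b\circ_2\mathsf{E}_{a'}$ for $0\le a,a'\le b\le c$ and $\mathsf{E}_b\circ_1\mathsf{E}_a-\mathsf{E}_a\circ_2\mathsf{E}_b$ for $0\le a<b\le c$. Its Koszul dual ${\mathbf{Hi}_{\underline{c}}}^!$ is the quotient of the free operad on the dual arity-$2$ generators $\mathsf{E}^\star_0,\dots,\mathsf{E}^\star_c$ by the ideal generated by the annihilator $R^\perp$ of $R$ for the pairing in arity $3$ given by $\langle\mathsf{E}^\star_x\circ_i\mathsf{E}^\star_y,\mathsf{E}_{x'}\circ_{i'}\mathsf{E}_{y'}\rangle:=1$ if $(x,y,i)=(x',y',i')$ and $i=1$, $-1$ if $(x,y,i)=(x',y',i')$ and $i=2$, and $0$ otherwise. In ${\mathbf{Hi}_{\underline{c}}}^!$, the symbol $\mathsf{K}^\star_b$ stands for the element $\mathsf{K}^\star_b:=\sum_{a\in\{0,\dots,b\}}\mathsf{E}^\star_a$,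 $b\in\{0,\dots,c\}$. -}

module Defs where

open import Algebra.Apartness.Bundles using (HeytingField; HeytingCommutativeRing)
open import Algebra.Bundles using (CommutativeRing; CommutativeMonoid)
open import Algebra.Module.Bundles using (LeftModule)
open import Algebra.Module.Morphism.Structures using (module LeftModuleMorphisms)
open import Algebra.Module.Structures using (IsLeftModule)
import Algebra.Definitions.RawMonoid as RawMonoidDefinitions
import Algebra.Properties.AbelianGroup as AbelianGroupProperties
import Algebra.Properties.CommutativeSemigroup as CommutativeSemigroupProperties
import Algebra.Properties.Ring as RingProperties
open import Data.Bool.Base using (if_then_else_; _∧_)
open import Data.Empty using (⊥-elim)
open import Data.Fin.Base using (Fin; zero; suc; toℕ) renaming (_≤_ to _≤ᶠ_; _<_ to _<ᶠ_)
open import Data.Fin.Properties using (toℕ≤pred[n]) renaming (_≟_ to _≟ᶠ_; _≤?_ to _≤ᶠ?_)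
open import Data.List.Base
  using (List; []; _∷_; _++_; [_]; map; foldr; filter; allFin; cartesianProductWith; length)
open import Data.List.Properties using (++-assoc; ++-identityʳ; map-++; length-filter)
open import Data.Nat.Base using (ℕ; zero; suc; _∸_; z≤n; s≤s) renaming (_+_ to _+ⁿ_; _≤_ to _≤ⁿ_; _<_ to _<ⁿ_)
open import Data.Nat.Properties
  using (≡-irrelevant; +-assoc; +-comm; +-suc; +-mono-≤; ≤-refl; ≤-trans; ≤-reflexive;
         m≤m+n; +-∸-comm; [m+n]∸[m+o]≡n∸o; ≰⇒>; <⇒≤; <⇒≱; ∸-monoˡ-<; ∸-monoˡ-≤; +-monoˡ-<; +-monoˡ-≤; m+n∸m≡n)
  renaming (_≤?_ to _≤ⁿ?_)
open import Data.Product.Base using (Σ-syntax; _×_; _,_; proj₁; proj₂; map₁)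
open import Level using (Level; _⊔_) renaming (suc to lsuc)
open import Relation.Binary.Definitions using (DecidableEquality)
open import Relation.Binary.PropositionalEquality
  using (_≡_; subst; cong; cong₂) renaming (refl to ≡-refl; sym to ≡-sym; trans to ≡-trans)
open import Relation.Nullary using (¬_; yes; no; does; ¬?)
open import Relation.Nullary.Decidable using (map′; _×-dec_; dec-true; dec-false)
open import Relation.Unary using (Pred)

-- `size` counts the internal nodes, so a tree `t` has `suc (size t)` leaves.
data Tree (k : ℕ) : Set where
  leaf : Tree k
  node : Fin k → Tree k → Tree k → Tree k

size : ∀ {k} → Tree k → ℕ
size leaf         = 0
size (node _ l r) = suc (size l +ⁿ size r)

-- `graft t i s` glues the root of `s` onto the leaf number `i` of `t`, leaves
-- being numbered from left to right starting at 0. Only `i ≤ size t` matters.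
graft : ∀ {k} → Tree k → ℕ → Tree k → Tree k
graft leaf         i s = s
graft (node a l r) i s =
  if does (i ≤ⁿ? size l) then node a (graft l i s) r
                         else node a l (graft r (i ∸ suc (size l)) s)

infix 4 _≟ᵗ_
_≟ᵗ_ : ∀ {k} → DecidableEquality (Tree k)
leaf       ≟ᵗ leaf          = yes ≡-refl
leaf       ≟ᵗ node _ _ _    = no λ ()
node _ _ _ ≟ᵗ leaf          = no λ ()
node a l r ≟ᵗ node a′ l′ r′ =
  map′ (λ { (≡-refl , ≡-refl , ≡-refl) → ≡-refl })
       (λ { ≡-refl → ≡-refl , ≡-refl , ≡-refl })
       (a ≟ᶠ a′ ×-dec l ≟ᵗ l′ ×-dec r ≟ᵗ r′)

module _ {k : ℕ} where

  graft-left : ∀ {a} (l r s : Tree k) {i} → i ≤ⁿ size l →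
               graft (node a l r) i s ≡ node a (graft l i s) r
  graft-left l r s {i} i≤ rewrite dec-true (i ≤ⁿ? size l) i≤ = ≡-refl

  graft-right : ∀ {a} (l r s : Tree k) {i} → size l <ⁿ i →
                graft (node a l r) i s ≡ node a l (graft r (i ∸ suc (size l)) s)
  graft-right l r s {i} l<i rewrite dec-false (i ≤ⁿ? size l) (<⇒≱ l<i) = ≡-refl

  size-graft : ∀ (t : Tree k) i s → size (graft t i s) ≡ size t +ⁿ size s
  size-graft leaf         i s = ≡-refl
  size-graft (node a l r) i s with i ≤ⁿ? size l
  ... | yes i≤l = ≡-trans (cong size (graft-left {a = a} l r s i≤l)) (cong suc
          (≡-trans (cong (_+ⁿ size r) (size-graft l i s))
          (≡-trans (+-assoc (size l) (size s) (size r))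
          (≡-trans (cong (size l +ⁿ_) (+-comm (size s) (size r)))
                   (≡-sym (+-assoc (size l) (size r) (size s)))))))
  ... | no  i≰l = ≡-trans (cong size (graft-right {a = a} l r s (≰⇒> i≰l))) (cong suc
          (≡-trans (cong (size l +ⁿ_) (size-graft r _ s))
                   (≡-sym (+-assoc (size l) (size r) (size s)))))

  graft-identityʳ : ∀ (t : Tree k) i → graft t i leaf ≡ t
  graft-identityʳ leaf         i = ≡-refl
  graft-identityʳ (node a l r) i with i ≤ⁿ? size l
  ... | yes i≤l = ≡-trans (graft-left l r leaf i≤l) (cong (λ t → node a t r) (graft-identityʳ l i))
  ... | no  i≰l = ≡-trans (graft-right l r leaf (≰⇒> i≰l)) (cong (node a l) (graft-identityʳ r _))

  graft-sequential : ∀ (t s u : Tree k) i j → i ≤ⁿ size t → j ≤ⁿ size s →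
                     graft (graft t i s) (i +ⁿ j) u ≡ graft t i (graft s j u)
  graft-sequential leaf         s u zero j _  _  = ≡-refl
  graft-sequential (node a l r) s u i    j i≤ j≤ with i ≤ⁿ? size l
  ... | yes i≤l =
    ≡-trans (cong (λ t → graft t (i +ⁿ j) u) (graft-left {a = a} l r s i≤l))
    (≡-trans (graft-left (graft l i s) r u
                (≤-trans (+-mono-≤ i≤l j≤) (≤-reflexive (≡-sym (size-graft l i s)))))
    (≡-trans (cong (λ t → node a t r) (graft-sequential l s u i j i≤l j≤))
             (≡-sym (graft-left l r (graft s j u) i≤l))))
  ... | no  i≰l =
    ≡-trans (cong (λ t → graft t (i +ⁿ j) u) (graft-right {a = a} l r s l<i))
    (≡-trans (graft-right l (graft r (i ∸ suc (size l)) s) u (≤-trans l<i (m≤m+n i j)))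
    (≡-trans (cong (λ m → node a l (graft (graft r (i ∸ suc (size l)) s) m u)) (+-∸-comm j l<i))
    (≡-trans (cong (node a l) (graft-sequential r s u (i ∸ suc (size l)) j
                (≤-trans (∸-monoˡ-≤ (suc (size l)) i≤) (≤-reflexive (m+n∸m≡n (size l) (size r)))) j≤))
             (≡-sym (graft-right l r (graft s j u) l<i)))))
    where l<i = ≰⇒> i≰l

  graft-parallel : ∀ (t s u : Tree k) i j → i <ⁿ j → j ≤ⁿ size t →
                   graft (graft t i s) (j +ⁿ size s) u ≡ graft (graft t j u) i s
  graft-parallel leaf         s u i zero ()  _
  graft-parallel (node a l r) s u i j    i<j j≤ with i ≤ⁿ? size l | j ≤ⁿ? size l
  ... | yes i≤l | yes j≤l =
    ≡-trans (cong (λ t → graft t (j +ⁿ size s) u) (graft-left {a = a} l r s i≤l))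
    (≡-trans (graft-left (graft l i s) r u
                (≤-trans (+-monoˡ-≤ (size s) j≤l) (≤-reflexive (≡-sym (size-graft l i s)))))
    (≡-trans (cong (λ t → node a t r) (graft-parallel l s u i j i<j j≤l))
    (≡-trans (≡-sym (graft-left (graft l j u) r s
                (≤-trans i≤l (≤-trans (m≤m+n (size l) (size u)) (≤-reflexive (≡-sym (size-graft l j u)))))))
             (cong (λ t → graft t i s) (≡-sym (graft-left {a = a} l r u j≤l))))))
  ... | yes i≤l | no  j≰l =
    ≡-trans (cong (λ t → graft t (j +ⁿ size s) u) (graft-left {a = a} l r s i≤l))
    (≡-trans (graft-right (graft l i s) r u
                (≤-trans (s≤s (≤-reflexive (size-graft l i s))) (+-monoˡ-< (size s) l<j)))
    (≡-trans (cong (λ m → node a (graft l i s) (graft r m u))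
                (≡-trans (cong (λ m → j +ⁿ size s ∸ suc m) (size-graft l i s))
                (≡-trans (cong₂ _∸_ (+-comm j (size s)) (cong suc (+-comm (size l) (size s))))
                (≡-trans (cong (size s +ⁿ j ∸_) (≡-sym (+-suc (size s) (size l))))
                         ([m+n]∸[m+o]≡n∸o (size s) j (suc (size l)))))))
    (≡-trans (≡-sym (graft-left l (graft r (j ∸ suc (size l)) u) s i≤l))
             (cong (λ t → graft t i s) (≡-sym (graft-right {a = a} l r u l<j))))))
    where l<j = ≰⇒> j≰l
  ... | no  i≰l | yes j≤l = ⊥-elim (i≰l (≤-trans (<⇒≤ i<j) j≤l))
  ... | no  i≰l | no  j≰l =
    ≡-trans (cong (λ t → graft t (j +ⁿ size s) u) (graft-right {a = a} l r s l<i))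
    (≡-trans (graft-right l (graft r (i ∸ suc (size l)) s) u (≤-trans l<j (m≤m+n j (size s))))
    (≡-trans (cong (λ m → node a l (graft (graft r (i ∸ suc (size l)) s) m u)) (+-∸-comm (size s) l<j))
    (≡-trans (cong (node a l) (graft-parallel r s u (i ∸ suc (size l)) (j ∸ suc (size l))
                (∸-monoˡ-< i<j l<i)
                (≤-trans (∸-monoˡ-≤ (suc (size l)) j≤) (≤-reflexive (m+n∸m≡n (size l) (size r))))))
    (≡-trans (≡-sym (graft-right l (graft r (j ∸ suc (size l)) u) s l<i))
             (cong (λ t → graft t i s) (≡-sym (graft-right {a = a} l r u l<j)))))))
    where
    l<i = ≰⇒> i≰l
    l<j = ≰⇒> j≰l

Tree[_] : ℕ → ℕ → Set
Tree[ k ] n = Σ[ t ∈ Tree k ] size t ≡ n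

module _ {k : ℕ} where

  tree-≡ : ∀ {n} {t s : Tree[ k ] n} → proj₁ t ≡ proj₁ s → t ≡ s
  tree-≡ {t = t , p} {s = .t , q} ≡-refl = cong (t ,_) (≡-irrelevant p q)

  infix 4 _≟_
  _≟_ : ∀ {n} → DecidableEquality (Tree[ k ] n)
  t ≟ s = map′ tree-≡ (cong proj₁) (proj₁ t ≟ᵗ proj₁ s)

  infixl 7 _⊲[_]_
  _⊲[_]_ : ∀ {n p} → Tree[ k ] n → Fin (suc n) → Tree[ k ] p → Tree[ k ] (n +ⁿ p)
  (t , |t|) ⊲[ i ] (s , |s|) =
    graft t (toℕ i) s , ≡-trans (size-graft t (toℕ i) s) (cong₂ _+ⁿ_ |t| |s|)

  subst-tree : ∀ {m n} (e : m ≡ n) (t : Tree[ k ] m) → proj₁ (subst Tree[ k ] e t) ≡ proj₁ t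
  subst-tree ≡-refl t = ≡-refl

  ⊲-identityˡ : ∀ {n} (t : Tree[ k ] n) i → (leaf , ≡-refl) ⊲[ i ] t ≡ t
  ⊲-identityˡ t i = tree-≡ ≡-refl

  ⊲-identityʳ : ∀ {n} (t : Tree[ k ] n) i (e : n +ⁿ 0 ≡ n) →
                subst Tree[ k ] e (t ⊲[ i ] (leaf , ≡-refl)) ≡ t
  ⊲-identityʳ (t , |t|) i e = tree-≡ (≡-trans (subst-tree e _) (graft-identityʳ t (toℕ i)))

  ⊲-sequential : ∀ {n p q} (t : Tree[ k ] n) (s : Tree[ k ] p) (u : Tree[ k ] q) i j j′ →
                 toℕ j′ ≡ toℕ i +ⁿ toℕ j → (e : (n +ⁿ p) +ⁿ q ≡ n +ⁿ (p +ⁿ q)) →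
                 subst Tree[ k ] e ((t ⊲[ i ] s) ⊲[ j′ ] u) ≡ t ⊲[ i ] (s ⊲[ j ] u)
  ⊲-sequential (t , ≡-refl) (s , ≡-refl) (u , |u|) i j j′ eq e = tree-≡ (≡-trans (subst-tree e _)
    (≡-trans (cong (λ m → graft (graft t (toℕ i) s) m u) eq)
             (graft-sequential t s u (toℕ i) (toℕ j) (toℕ≤pred[n] i) (toℕ≤pred[n] j))))

  ⊲-parallel : ∀ {n p q} (t : Tree[ k ] n) (s : Tree[ k ] p) (u : Tree[ k ] q) i j i′ j′ →
               i <ᶠ j → toℕ i′ ≡ toℕ i → toℕ j′ ≡ toℕ j +ⁿ p →
               (e : (n +ⁿ p) +ⁿ q ≡ (n +ⁿ q) +ⁿ p) →
               subst Tree[ k ] e ((t ⊲[ i ] s) ⊲[ j′ ] u) ≡ (t ⊲[ j ] u) ⊲[ i′ ] s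
  ⊲-parallel (t , ≡-refl) (s , ≡-refl) (u , |u|) i j i′ j′ i<j i′≡ j′≡ e = tree-≡ (≡-trans (subst-tree e _)
    (≡-trans (cong (λ m → graft (graft t (toℕ i) s) m u) j′≡)
    (≡-trans (graft-parallel t s u (toℕ i) (toℕ j) i<j (toℕ≤pred[n] j))
             (cong (λ m → graft (graft t (toℕ j) u) m s) (≡-sym i′≡)))))

module _ {a ℓ₁ ℓ₂} (𝕂 : HeytingField a ℓ₁ ℓ₂) where

  scalars : CommutativeRing a ℓ₁
  scalars = HeytingCommutativeRing.commutativeRing (HeytingField.heytingCommutativeRing 𝕂)

  open CommutativeRing scalars
    renaming (Carrier to K; +-assoc to +ᴷ-assoc; +-comm to +ᴷ-comm)
    hiding (zero)

  private
    module K₊ = AbelianGroupProperties +-abelianGroup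
    module Kₛ = CommutativeSemigroupProperties +-commutativeSemigroup
    module Kₚ = CommutativeSemigroupProperties *-commutativeSemigroup
    module Kᵣ = RingProperties ring

  CharacteristicZero : Set ℓ₁
  CharacteristicZero = ∀ n → ¬ (suc n ×′ 1# ≈ 0#)
    where open RawMonoidDefinitions +-rawMonoid renaming (_×_ to _×′_) hiding (_×′_)

  VectorSpace : ∀ m ℓ → Set _
  VectorSpace m ℓ = LeftModule ring m ℓ

  -- Operads here have no element of arity 0, and the component of index `n` is
  -- the space of elements of arity `suc n`. The input positions are numbered
  -- from 0, so `x ∘[ i ] y` is the partial composition at the input `i + 1`.
  record Operad m ℓ : Set (a ⊔ ℓ₁ ⊔ lsuc (m ⊔ ℓ)) where
    infixl 7 _∘[_]_
    field
      component : ℕ → VectorSpace m ℓ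

    open module Component {n} = LeftModule (component n) public

    Elt : ℕ → Set m
    Elt n = Carrierᴹ {n}

    field
      𝟙      : Elt 0
      _∘[_]_ : ∀ {n p} → Elt n → Fin (suc n) → Elt p → Elt (n +ⁿ p)

      ∘-cong : ∀ {n p} {x x′ : Elt n} {y y′ : Elt p} i →
               x ≈ᴹ x′ → y ≈ᴹ y′ → x ∘[ i ] y ≈ᴹ x′ ∘[ i ] y′
      +-∘    : ∀ {n p} (x x′ : Elt n) i (y : Elt p) →
               (x +ᴹ x′) ∘[ i ] y ≈ᴹ x ∘[ i ] y +ᴹ x′ ∘[ i ] y
      ∘-+    : ∀ {n p} (x : Elt n) i (y y′ : Elt p) →
               x ∘[ i ] (y +ᴹ y′) ≈ᴹ x ∘[ i ] y +ᴹ x ∘[ i ] y′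
      *-∘    : ∀ {n p} k (x : Elt n) i (y : Elt p) →
               (k *ₗ x) ∘[ i ] y ≈ᴹ k *ₗ (x ∘[ i ] y)
      ∘-*    : ∀ {n p} k (x : Elt n) i (y : Elt p) →
               x ∘[ i ] (k *ₗ y) ≈ᴹ k *ₗ (x ∘[ i ] y)

      identityˡ : ∀ {n} (x : Elt n) i → 𝟙 ∘[ i ] x ≈ᴹ x
      identityʳ : ∀ {n} (x : Elt n) i (e : n +ⁿ 0 ≡ n) →
                  subst Elt e (x ∘[ i ] 𝟙) ≈ᴹ x

      sequential : ∀ {n p q} (x : Elt n) (y : Elt p) (z : Elt q) i j j′ →
                   toℕ j′ ≡ toℕ i +ⁿ toℕ j →
                   (e : (n +ⁿ p) +ⁿ q ≡ n +ⁿ (p +ⁿ q)) →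
                   subst Elt e ((x ∘[ i ] y) ∘[ j′ ] z) ≈ᴹ x ∘[ i ] (y ∘[ j ] z)
      parallel   : ∀ {n p q} (x : Elt n) (y : Elt p) (z : Elt q) i j i′ j′ →
                   i <ᶠ j → toℕ i′ ≡ toℕ i → toℕ j′ ≡ toℕ j +ⁿ p →
                   (e : (n +ⁿ p) +ⁿ q ≡ (n +ⁿ q) +ⁿ p) →
                   subst Elt e ((x ∘[ i ] y) ∘[ j′ ] z) ≈ᴹ (x ∘[ j ] z) ∘[ i′ ] y

    infixl 6 _-ᴹ_
    _-ᴹ_ : ∀ {n} → Elt n → Elt n → Elt n
    x -ᴹ y = x +ᴹ -ᴹ y

  infix 4 _≅_
  record _≅_ {m ℓ m′ ℓ′} (P : Operad m ℓ) (Q : Operad m′ ℓ′) : Set (a ⊔ m ⊔ ℓ ⊔ m′ ⊔ ℓ′) where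
    private
      module P = Operad P
      module Q = Operad Q
    field
      to     : ∀ {n} → P.Elt n → Q.Elt n
      linear : ∀ n → LeftModuleMorphisms.IsLeftModuleIsomorphism
                       (P.rawLeftModule {n}) (Q.rawLeftModule {n}) to
      𝟙-homo : to P.𝟙 Q.≈ᴹ Q.𝟙
      ∘-homo : ∀ {n p} (x : P.Elt n) i (y : P.Elt p) →
               to (x P.∘[ i ] y) Q.≈ᴹ to x Q.∘[ i ] to y

  record Ideal {m ℓ} (P : Operad m ℓ) r : Set (a ⊔ m ⊔ ℓ ⊔ lsuc r) where
    open Operad P
    field
      Member : ∀ {n} → Pred (Elt n) r
      ≈-mem  : ∀ {n} {x y : Elt n} → x ≈ᴹ y → Member x → Member y
      0-mem  : ∀ {n} → Member (0ᴹ {n})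
      +-mem  : ∀ {n} {x y : Elt n} → Member x → Member y → Member (x +ᴹ y)
      *-mem  : ∀ {n} k {x : Elt n} → Member x → Member (k *ₗ x)
      mem-∘  : ∀ {n p} {x : Elt n} i (y : Elt p) → Member x → Member (x ∘[ i ] y)
      ∘-mem  : ∀ {n p} (x : Elt n) i {y : Elt p} → Member y → Member (x ∘[ i ] y)

  data Generated {m ℓ s d} (P : Operad m ℓ) (S : Pred (Operad.Elt P d) s) :
                 ∀ {n} → Pred (Operad.Elt P n) (a ⊔ m ⊔ ℓ ⊔ s) where
    generator : ∀ {x} → S x → Generated P S x
    ≈-mem     : ∀ {n} {x y : Operad.Elt P n} → Operad._≈ᴹ_ P x y → Generated P S x → Generated P S y
    0-mem     : ∀ {n} → Generated P S (Operad.0ᴹ P {n})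
    +-mem     : ∀ {n} {x y : Operad.Elt P n} →
                Generated P S x → Generated P S y → Generated P S (Operad._+ᴹ_ P x y)
    *-mem     : ∀ {n} k {x : Operad.Elt P n} → Generated P S x → Generated P S (Operad._*ₗ_ P k x)
    mem-∘     : ∀ {n p} {x : Operad.Elt P n} i (y : Operad.Elt P p) →
                Generated P S x → Generated P S (Operad._∘[_]_ P x i y)
    ∘-mem     : ∀ {n p} (x : Operad.Elt P n) i {y : Operad.Elt P p} →
                Generated P S y → Generated P S (Operad._∘[_]_ P x i y)

  ⟨_⟩ : ∀ {m ℓ s d} {P : Operad m ℓ} → Pred (Operad.Elt P d) s → Ideal P (a ⊔ m ⊔ ℓ ⊔ s)
  ⟨_⟩ {P = P} S = record
    { Member = Generated P S
    ; ≈-mem  = ≈-mem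
    ; 0-mem  = 0-mem
    ; +-mem  = +-mem
    ; *-mem  = *-mem
    ; mem-∘  = mem-∘
    ; ∘-mem  = ∘-mem
    }

  module VectorSpaceProperties {m ℓ} (V : VectorSpace m ℓ) where
    open LeftModule V
    open AbelianGroupProperties +ᴹ-abelianGroup public
      using (⁻¹-∙-comm; inverseʳ-unique; ⁻¹-involutive; ε⁻¹≈ε)
    open CommutativeSemigroupProperties (CommutativeMonoid.commutativeSemigroup +ᴹ-commutativeMonoid) public
      using (interchange)

    -1*x≈-x : ∀ x → (- 1#) *ₗ x ≈ᴹ -ᴹ x
    -1*x≈-x x = inverseʳ-unique x _ (≈ᴹ-trans (+ᴹ-congʳ (≈ᴹ-sym (*ₗ-identityˡ x)))
      (≈ᴹ-trans (≈ᴹ-sym (*ₗ-distribʳ x 1# (- 1#)))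
      (≈ᴹ-trans (*ₗ-congʳ (-‿inverseʳ 1#)) (*ₗ-zeroˡ x))))

    *-‿- : ∀ k x → k *ₗ (-ᴹ x) ≈ᴹ -ᴹ (k *ₗ x)
    *-‿- k x = inverseʳ-unique (k *ₗ x) _ (≈ᴹ-trans (≈ᴹ-sym (*ₗ-distribˡ k x (-ᴹ x)))
      (≈ᴹ-trans (*ₗ-congˡ (-ᴹ‿inverseʳ x)) (*ₗ-zeroʳ k)))

    telescope : ∀ x y z → (x +ᴹ -ᴹ y) +ᴹ (y +ᴹ -ᴹ z) ≈ᴹ x +ᴹ -ᴹ z
    telescope x y z = ≈ᴹ-trans (+ᴹ-assoc x (-ᴹ y) _) (+ᴹ-congˡ
      (≈ᴹ-trans (≈ᴹ-sym (+ᴹ-assoc (-ᴹ y) y _))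
      (≈ᴹ-trans (+ᴹ-congʳ (-ᴹ‿inverseˡ y)) (+ᴹ-identityˡ _))))

    swap- : ∀ x y → -ᴹ (x +ᴹ -ᴹ y) ≈ᴹ y +ᴹ -ᴹ x
    swap- x y = ≈ᴹ-trans (≈ᴹ-sym (⁻¹-∙-comm x (-ᴹ y)))
      (≈ᴹ-trans (+ᴹ-comm _ _) (+ᴹ-congʳ (⁻¹-involutive y)))

  module _ {m ℓ r} (P : Operad m ℓ) (I : Ideal P r) where
    open Operad P
    private
      open module Props {n} = VectorSpaceProperties (component n)
      module I = Ideal I

    -- A record rather than a synonym, so that `x` and `y` can be inferred.
    record Congruent {n} (x y : Elt n) : Set r where
      constructor congruent
      field difference : I.Member (x -ᴹ y)

    neg : ∀ {n} {x : Elt n} → I.Member x → I.Member (-ᴹ x)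
    neg {x = x} x∈I = I.≈-mem (-1*x≈-x x) (I.*-mem (- 1#) x∈I)

    ≈⇒Congruent : ∀ {n} {x y : Elt n} → x ≈ᴹ y → Congruent x y
    ≈⇒Congruent {y = y} x≈y = congruent (I.≈-mem
      (≈ᴹ-sym (≈ᴹ-trans (+ᴹ-congʳ x≈y) (-ᴹ‿inverseʳ y))) I.0-mem)

    symᶜ : ∀ {n} {x y : Elt n} → Congruent x y → Congruent y x
    symᶜ {x = x} {y} (congruent d) = congruent (I.≈-mem (swap- x y) (neg d))

    transᶜ : ∀ {n} {x y z : Elt n} → Congruent x y → Congruent y z → Congruent x z
    transᶜ {x = x} {y} {z} (congruent d) (congruent e) =
      congruent (I.≈-mem (telescope x y z) (I.+-mem d e))

    +-congᶜ : ∀ {n} {x x′ y y′ : Elt n} →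
              Congruent x x′ → Congruent y y′ → Congruent (x +ᴹ y) (x′ +ᴹ y′)
    +-congᶜ {x = x} {x′} {y} {y′} (congruent d) (congruent e) = congruent (I.≈-mem
      (≈ᴹ-trans (interchange x (-ᴹ x′) y (-ᴹ y′)) (+ᴹ-congˡ (⁻¹-∙-comm x′ y′)))
      (I.+-mem d e))

    *-congᶜ : ∀ {n k k′} {x x′ : Elt n} → k ≈ k′ → Congruent x x′ → Congruent (k *ₗ x) (k′ *ₗ x′)
    *-congᶜ {k = k} {x = x} {x′} k≈k′ (congruent d) = congruent (I.≈-mem
      (≈ᴹ-trans (*ₗ-distribˡ k x (-ᴹ x′)) (+ᴹ-congˡ
        (≈ᴹ-trans (*-‿- k x′) (-ᴹ‿cong (*ₗ-congʳ k≈k′)))))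
      (I.*-mem k d))

    -‿congᶜ : ∀ {n} {x y : Elt n} → Congruent x y → Congruent (-ᴹ x) (-ᴹ y)
    -‿congᶜ {x = x} {y} (congruent d) =
      congruent (I.≈-mem (≈ᴹ-sym (⁻¹-∙-comm x (-ᴹ y))) (neg d))

    ∘-congᶜ : ∀ {n p} {x x′ : Elt n} {y y′ : Elt p} i →
              Congruent x x′ → Congruent y y′ → Congruent (x ∘[ i ] y) (x′ ∘[ i ] y′)
    ∘-congᶜ {x = x} {x′} {y} {y′} i (congruent d) (congruent e) = transᶜ
      (congruent (I.≈-mem (≈ᴹ-trans (+-∘ x (-ᴹ x′) i y) (+ᴹ-congˡ
          (≈ᴹ-trans (∘-cong i (≈ᴹ-sym (-1*x≈-x x′)) ≈ᴹ-refl)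
          (≈ᴹ-trans (*-∘ (- 1#) x′ i y) (-1*x≈-x _)))))
        (I.mem-∘ i y d)))
      (congruent (I.≈-mem (≈ᴹ-trans (∘-+ x′ i y (-ᴹ y′)) (+ᴹ-congˡ
          (≈ᴹ-trans (∘-cong i ≈ᴹ-refl (≈ᴹ-sym (-1*x≈-x y′)))
          (≈ᴹ-trans (∘-* (- 1#) x′ i y′) (-1*x≈-x _)))))
        (I.∘-mem x′ i e)))

    _/_ : Operad m r
    _/_ = record
      { component = λ n → record
        { Carrierᴹ = Elt n
        ; _≈ᴹ_ = Congruent
        ; _+ᴹ_ = _+ᴹ_
        ; _*ₗ_ = _*ₗ_
        ; 0ᴹ = 0ᴹ
        ; -ᴹ_ = -ᴹ_
        ; isLeftModule = record
          { isLeftSemimodule = record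
            { +ᴹ-isCommutativeMonoid = record
              { isMonoid = record
                { isSemigroup = record
                  { isMagma = record
                    { isEquivalence = record
                      { refl = ≈⇒Congruent ≈ᴹ-refl ; sym = symᶜ ; trans = transᶜ }
                    ; ∙-cong = +-congᶜ
                    }
                  ; assoc = λ x y z → ≈⇒Congruent (+ᴹ-assoc x y z)
                  }
                ; identity = (λ x → ≈⇒Congruent (+ᴹ-identityˡ x)) , (λ x → ≈⇒Congruent (+ᴹ-identityʳ x))
                }
              ; comm = λ x y → ≈⇒Congruent (+ᴹ-comm x y)
              }
            ; isPreleftSemimodule = record
              { *ₗ-cong = *-congᶜ
              ; *ₗ-zeroˡ = λ x → ≈⇒Congruent (*ₗ-zeroˡ x)
              ; *ₗ-distribʳ = λ x k l → ≈⇒Congruent (*ₗ-distribʳ x k l)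
              ; *ₗ-identityˡ = λ x → ≈⇒Congruent (*ₗ-identityˡ x)
              ; *ₗ-assoc = λ k l x → ≈⇒Congruent (*ₗ-assoc k l x)
              ; *ₗ-zeroʳ = λ k → ≈⇒Congruent (*ₗ-zeroʳ k)
              ; *ₗ-distribˡ = λ k x y → ≈⇒Congruent (*ₗ-distribˡ k x y)
              }
            }
          ; -ᴹ‿cong = -‿congᶜ
          ; -ᴹ‿inverse = (λ x → ≈⇒Congruent (-ᴹ‿inverseˡ x)) , (λ x → ≈⇒Congruent (-ᴹ‿inverseʳ x))
          }
        }
      ; 𝟙          = 𝟙
      ; _∘[_]_     = _∘[_]_
      ; ∘-cong     = ∘-congᶜ
      ; +-∘        = λ x x′ i y → ≈⇒Congruent (+-∘ x x′ i y)
      ; ∘-+        = λ x i y y′ → ≈⇒Congruent (∘-+ x i y y′)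
      ; *-∘        = λ k x i y → ≈⇒Congruent (*-∘ k x i y)
      ; ∘-*        = λ k x i y → ≈⇒Congruent (∘-* k x i y)
      ; identityˡ  = λ x i → ≈⇒Congruent (identityˡ x i)
      ; identityʳ  = λ x i e → ≈⇒Congruent (identityʳ x i e)
      ; sequential = λ x y z i j j′ eq e → ≈⇒Congruent (sequential x y z i j j′ eq e)
      ; parallel   = λ x y z i j i′ j′ i<j i′≡ j′≡ e →
                       ≈⇒Congruent (parallel x y z i j i′ j′ i<j i′≡ j′≡ e)
      }

  Combination : Set → Set a
  Combination B = List (K × B)

  module _ {B : Set} where

    extend : (B → K) → Combination B → K
    extend h = foldr (λ (k , b) acc → k * h b + acc) 0#

    scaleᶜ : K → Combination B → Combination B
    scaleᶜ k = map (map₁ (k *_))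

    negᶜ : Combination B → Combination B
    negᶜ = map (map₁ (-_))

    extend-++ : ∀ h xs ys → extend h (xs ++ ys) ≈ extend h xs + extend h ys
    extend-++ h []       ys = sym (+-identityˡ _)
    extend-++ h (x ∷ xs) ys = trans (+-congˡ (extend-++ h xs ys)) (sym (+ᴷ-assoc _ _ _))

    extend-scale : ∀ h k xs → extend h (scaleᶜ k xs) ≈ k * extend h xs
    extend-scale h k []             = sym (zeroʳ k)
    extend-scale h k ((l , b) ∷ xs) =
      trans (+-cong (*-assoc k l (h b)) (extend-scale h k xs)) (sym (distribˡ k _ _))

    extend-neg : ∀ h xs → extend h (negᶜ xs) ≈ - extend h xs
    extend-neg h []             = sym K₊.ε⁻¹≈ε
    extend-neg h ((l , b) ∷ xs) =
      trans (+-cong (sym (Kᵣ.-‿distribˡ-* l (h b))) (extend-neg h xs)) (K₊.⁻¹-∙-comm _ _)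

    extend-ext : ∀ {h h′} xs → (∀ b → h b ≈ h′ b) → extend h xs ≈ extend h′ xs
    extend-ext []             eq = refl
    extend-ext ((k , b) ∷ xs) eq = +-cong (*-congˡ (eq b)) (extend-ext xs eq)

    extend-0 : ∀ xs → extend (λ _ → 0#) xs ≈ 0#
    extend-0 []             = refl
    extend-0 ((k , _) ∷ xs) = trans (+-cong (zeroʳ k) (extend-0 xs)) (+-identityˡ 0#)

    extend-+ : ∀ h h′ xs → extend (λ b → h b + h′ b) xs ≈ extend h xs + extend h′ xs
    extend-+ h h′ []             = sym (+-identityˡ 0#)
    extend-+ h h′ ((k , b) ∷ xs) = trans (+-cong (distribˡ k (h b) (h′ b)) (extend-+ h h′ xs))
      (Kₛ.interchange _ _ _ _)

    extend-* : ∀ k h xs → extend (λ b → k * h b) xs ≈ k * extend h xs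
    extend-* k h []             = sym (zeroʳ k)
    extend-* k h ((l , b) ∷ xs) = trans (+-cong (Kₚ.x∙yz≈y∙xz l k (h b)) (extend-* k h xs))
      (sym (distribˡ k _ _))

    extend-singleton : ∀ h b → extend h [ (1# , b) ] ≈ h b
    extend-singleton h b = trans (+-identityʳ _) (*-identityˡ (h b))

  extend-swap : ∀ {B C : Set} (h : B → C → K) xs ys →
                extend (λ b → extend (h b) ys) xs ≈ extend (λ c → extend (λ b → h b c) xs) ys
  extend-swap h []             ys = sym (extend-0 ys)
  extend-swap h ((k , b) ∷ xs) ys =
    trans (+-cong (sym (extend-* k (h b) ys)) (extend-swap h xs ys)) (sym (extend-+ _ _ ys))

  module _ {B C D : Set} (_·_ : B → C → D) where

    bilinear : Combination B → Combination C → Combination D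
    bilinear = cartesianProductWith (λ (k , b) (l , c) → k * l , b · c)

    extend-map : ∀ h k b ys → extend h (map (λ (l , c) → k * l , b · c) ys) ≈
                              k * extend (λ c → h (b · c)) ys
    extend-map h k b []             = sym (zeroʳ k)
    extend-map h k b ((l , c) ∷ ys) =
      trans (+-cong (*-assoc k l _) (extend-map h k b ys)) (sym (distribˡ k _ _))

    extend-bilinear : ∀ h xs ys →
      extend h (bilinear xs ys) ≈ extend (λ b → extend (λ c → h (b · c)) ys) xs
    extend-bilinear h []             ys = refl
    extend-bilinear h ((k , b) ∷ xs) ys =
      trans (extend-++ h (map _ ys) _) (+-cong (extend-map h k b ys) (extend-bilinear h xs ys))

  module FreeVectorSpace {B : Set} (_≟ᴮ_ : DecidableEquality B) where

    δ : B → B → K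
    δ b b′ = if does (b ≟ᴮ b′) then 1# else 0#

    coefficient : B → Combination B → K
    coefficient b = extend (δ b)

    infix 4 _≋_
    record _≋_ (xs ys : Combination B) : Set ℓ₁ where
      constructor equal
      field coefficients : ∀ b → coefficient b xs ≈ coefficient b ys
    open _≋_

    remove : B → Combination B → Combination B
    remove b = filter (λ (_ , b′) → ¬? (b ≟ᴮ b′))

    δ-same : ∀ b → δ b b ≈ 1#
    δ-same b rewrite dec-true (b ≟ᴮ b) ≡-refl = refl

    δ-diff : ∀ {b b′} → ¬ b ≡ b′ → δ b b′ ≈ 0#
    δ-diff {b} {b′} b≢b′ rewrite dec-false (b ≟ᴮ b′) b≢b′ = refl

    extend-remove : ∀ h b xs → extend h xs ≈ coefficient b xs * h b + extend h (remove b xs)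
    extend-remove h b [] = sym (trans (+-congʳ (zeroˡ (h b))) (+-identityˡ 0#))
    extend-remove h b ((k , b′) ∷ xs) with b ≟ᴮ b′
    ... | yes ≡-refl = trans (+-congˡ (extend-remove h b xs)) (trans (sym (+ᴷ-assoc _ _ _))
          (+-congʳ (trans (sym (distribʳ (h b) k _)) (*-congʳ (+-congʳ (sym (*-identityʳ k)))))))
    ... | no  b≢b′ = trans (+-congˡ (extend-remove h b xs)) (trans (Kₛ.x∙yz≈y∙xz _ _ _)
          (+-congʳ (*-congʳ (sym (trans (+-congʳ (zeroʳ k)) (+-identityˡ _))))))

    extend-vanish : ∀ n h xs → length xs ≤ⁿ n → (∀ b → coefficient b xs ≈ 0#) → extend h xs ≈ 0#
    extend-vanish n h [] _ _ = refl
    extend-vanish (suc n) h ((k , b) ∷ xs) (s≤s |xs|≤n) xs≈0 =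
      trans (extend-remove h b ((k , b) ∷ xs))
      (trans (+-cong (trans (*-congʳ (xs≈0 b)) (zeroˡ (h b)))
        (extend-vanish n h (remove b ((k , b) ∷ xs)) shorter
          (λ b′ → trans (sym (+-identityˡ _))
            (trans (+-congʳ (sym (trans (*-congʳ (xs≈0 b)) (zeroˡ (δ b′ b)))))
            (trans (sym (extend-remove (δ b′) b ((k , b) ∷ xs))) (xs≈0 b′))))))
        (+-identityˡ 0#))
      where
      shorter : length (remove b ((k , b) ∷ xs)) ≤ⁿ n
      shorter rewrite dec-true (b ≟ᴮ b) ≡-refl =
        ≤-trans (length-filter (λ (_ , b′) → ¬? (b ≟ᴮ b′)) xs) |xs|≤n

    ≋⇒extend : ∀ h {xs ys} → xs ≋ ys → extend h xs ≈ extend h ys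
    ≋⇒extend h {xs} {ys} (equal eq) = K₊.x∙y⁻¹≈ε⇒x≈y _ _ (trans
      (sym (trans (extend-++ h xs (negᶜ ys)) (+-congˡ (extend-neg h ys))))
      (extend-vanish (length (xs ++ negᶜ ys)) h (xs ++ negᶜ ys) ≤-refl (λ b →
        trans (extend-++ (δ b) xs (negᶜ ys))
        (trans (+-cong (eq b) (extend-neg (δ b) ys)) (-‿inverseʳ _)))))

    extend⇒≋ : ∀ {xs ys} → (∀ h → extend h xs ≈ extend h ys) → xs ≋ ys
    extend⇒≋ eq = equal (λ b → eq (δ b))

    freeVectorSpace : VectorSpace a ℓ₁
    freeVectorSpace = record
      { Carrierᴹ = Combination B
      ; _≈ᴹ_ = _≋_
      ; _+ᴹ_ = _++_
      ; _*ₗ_ = scaleᶜ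
      ; 0ᴹ = []
      ; -ᴹ_ = negᶜ
      ; isLeftModule = record
        { isLeftSemimodule = record
          { +ᴹ-isCommutativeMonoid = record
            { isMonoid = record
              { isSemigroup = record
                { isMagma = record
                  { isEquivalence = record
                    { refl = equal λ b → refl
                    ; sym = λ (equal p) → equal λ b → sym (p b)
                    ; trans = λ (equal p) (equal q) → equal λ b → trans (p b) (q b)
                    }
                  ; ∙-cong = λ {xs} {xs′} {ys} {ys′} (equal p) (equal q) → equal λ b →
                      trans (extend-++ (δ b) xs ys)
                      (trans (+-cong (p b) (q b)) (sym (extend-++ (δ b) xs′ ys′)))
                  }
                ; assoc = λ xs ys zs → equal λ b → reflexive (cong (coefficient b) (++-assoc xs ys zs))
                }
              ; identity = (λ xs → equal λ b → refl)
                         , (λ xs → equal λ b → reflexive (cong (coefficient b) (++-identityʳ xs)))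
              }
            ; comm = λ xs ys → equal λ b → trans (extend-++ (δ b) xs ys)
                (trans (+ᴷ-comm _ _) (sym (extend-++ (δ b) ys xs)))
            }
          ; isPreleftSemimodule = record
            { *ₗ-cong = λ {k} {l} {xs} {ys} k≈l (equal p) → equal λ b →
                trans (extend-scale (δ b) k xs)
                (trans (*-cong k≈l (p b)) (sym (extend-scale (δ b) l ys)))
            ; *ₗ-zeroˡ = λ xs → equal λ b → trans (extend-scale (δ b) 0# xs) (zeroˡ _)
            ; *ₗ-distribʳ = λ xs k l → equal λ b → trans (extend-scale (δ b) (k + l) xs)
                (trans (distribʳ _ k l) (sym (trans (extend-++ (δ b) (scaleᶜ k xs) (scaleᶜ l xs))
                  (+-cong (extend-scale (δ b) k xs) (extend-scale (δ b) l xs)))))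
            ; *ₗ-identityˡ = λ xs → equal λ b → trans (extend-scale (δ b) 1# xs) (*-identityˡ _)
            ; *ₗ-assoc = λ k l xs → equal λ b → trans (extend-scale (δ b) (k * l) xs)
                (trans (*-assoc k l _) (sym (trans (extend-scale (δ b) k (scaleᶜ l xs))
                  (*-congˡ (extend-scale (δ b) l xs)))))
            ; *ₗ-zeroʳ = λ k → equal λ b → refl
            ; *ₗ-distribˡ = λ k xs ys → equal λ b →
                reflexive (cong (coefficient b) (map-++ (map₁ (k *_)) xs ys))
            }
          }
        ; -ᴹ‿cong = λ {xs} {ys} (equal p) → equal λ b → trans (extend-neg (δ b) xs)
            (trans (-‿cong (p b)) (sym (extend-neg (δ b) ys)))
        ; -ᴹ‿inverse =
            (λ xs → equal λ b → trans (extend-++ (δ b) (negᶜ xs) xs)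
              (trans (+-congʳ (extend-neg (δ b) xs)) (-‿inverseˡ _)))
          , (λ xs → equal λ b → trans (extend-++ (δ b) xs (negᶜ xs))
              (trans (+-congˡ (extend-neg (δ b) xs)) (-‿inverseʳ _)))
        }
      }

  module _ (k : ℕ) where

    private
      module Fr {n} = FreeVectorSpace (_≟_ {k} {n})
    open Fr

    extend-subst : ∀ {m n} h (e : m ≡ n) xs →
      extend h (subst (λ n → Combination (Tree[ k ] n)) e xs) ≈ extend (λ t → h (subst Tree[ k ] e t)) xs
    extend-subst h ≡-refl xs = refl

    compose : ∀ {n p} → Combination (Tree[ k ] n) → Fin (suc n) →
              Combination (Tree[ k ] p) → Combination (Tree[ k ] (n +ⁿ p))
    compose xs i ys = bilinear (λ t s → t ⊲[ i ] s) xs ys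

    extend-compose : ∀ {n p} h (xs : Combination (Tree[ k ] n)) i (ys : Combination (Tree[ k ] p)) →
      extend h (compose xs i ys) ≈ extend (λ t → extend (λ s → h (t ⊲[ i ] s)) ys) xs
    extend-compose h xs i ys = extend-bilinear (λ t s → t ⊲[ i ] s) h xs ys

    extend-composeˡ : ∀ {n p q} h (xs : Combination (Tree[ k ] n)) i (ys : Combination (Tree[ k ] p)) j
                      (zs : Combination (Tree[ k ] q)) →
      extend h (compose (compose xs i ys) j zs) ≈
      extend (λ t → extend (λ s → extend (λ u → h ((t ⊲[ i ] s) ⊲[ j ] u)) zs) ys) xs
    extend-composeˡ h xs i ys j zs =
      trans (extend-compose h (compose xs i ys) j zs) (extend-compose _ xs i ys)

    -- The basis of the component of arity `suc n` is the set of planar binary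
    -- trees with `n` internal nodes, each labelled by one of the `k` generators.
    FreeOperad : Operad a ℓ₁
    FreeOperad = record
      { component = λ n → freeVectorSpace {n}
      ; 𝟙 = [ (1# , leaf , ≡-refl) ]
      ; _∘[_]_ = compose
      ; ∘-cong = λ {_} {_} {xs} {xs′} {ys} {ys′} i p q → extend⇒≋ λ h →
          trans (extend-compose h xs i ys)
          (trans (≋⇒extend _ p)
          (trans (extend-ext xs′ (λ t → ≋⇒extend _ q)) (sym (extend-compose h xs′ i ys′))))
      ; +-∘ = λ xs xs′ i ys → extend⇒≋ λ h →
          trans (extend-compose h (xs ++ xs′) i ys)
          (trans (extend-++ _ xs xs′)
          (trans (sym (+-cong (extend-compose h xs i ys) (extend-compose h xs′ i ys)))
                 (sym (extend-++ h (compose xs i ys) (compose xs′ i ys)))))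
      ; ∘-+ = λ xs i ys ys′ → extend⇒≋ λ h →
          trans (extend-compose h xs i (ys ++ ys′))
          (trans (extend-ext xs (λ t → extend-++ _ ys ys′))
          (trans (extend-+ _ _ xs)
          (trans (sym (+-cong (extend-compose h xs i ys) (extend-compose h xs i ys′)))
                 (sym (extend-++ h (compose xs i ys) (compose xs i ys′))))))
      ; *-∘ = λ k xs i ys → extend⇒≋ λ h →
          trans (extend-compose h (scaleᶜ k xs) i ys)
          (trans (extend-scale _ k xs)
          (trans (*-congˡ (sym (extend-compose h xs i ys))) (sym (extend-scale h k (compose xs i ys)))))
      ; ∘-* = λ k xs i ys → extend⇒≋ λ h →
          trans (extend-compose h xs i (scaleᶜ k ys))
          (trans (extend-ext xs (λ t → extend-scale _ k ys))
          (trans (extend-* k _ xs)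
          (trans (*-congˡ (sym (extend-compose h xs i ys))) (sym (extend-scale h k (compose xs i ys))))))
      ; identityˡ = λ xs i → extend⇒≋ λ h →
          trans (extend-compose h [ (1# , leaf , ≡-refl) ] i xs)
          (trans (extend-singleton (λ t → extend (λ s → h (t ⊲[ i ] s)) xs) (leaf , ≡-refl))
                 (extend-ext xs (λ s → reflexive (cong h (⊲-identityˡ s i)))))
      ; identityʳ = λ xs i e → extend⇒≋ λ h →
          trans (extend-subst h e _)
          (trans (extend-compose _ xs i [ (1# , leaf , ≡-refl) ])
                 (extend-ext xs (λ t → trans
                   (extend-singleton (λ s → h (subst Tree[ k ] e (t ⊲[ i ] s))) (leaf , ≡-refl))
                   (reflexive (cong h (⊲-identityʳ t i e))))))
      ; sequential = λ xs ys zs i j j′ eq e → extend⇒≋ λ h →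
          trans (extend-subst h e _)
          (trans (extend-composeˡ _ xs i ys j′ zs)
          (trans (extend-ext xs λ t → extend-ext ys λ s → extend-ext zs λ u →
                   reflexive (cong h (⊲-sequential t s u i j j′ eq e)))
          (trans (extend-ext xs λ t → sym (extend-compose _ ys j zs))
                 (sym (extend-compose h xs i (compose ys j zs))))))
      ; parallel = λ xs ys zs i j i′ j′ i<j i′≡ j′≡ e → extend⇒≋ λ h →
          trans (extend-subst h e _)
          (trans (extend-composeˡ _ xs i ys j′ zs)
          (trans (extend-ext xs λ t → extend-ext ys λ s → extend-ext zs λ u →
                   reflexive (cong h (⊲-parallel t s u i j i′ j′ i<j i′≡ j′≡ e)))
          (trans (extend-ext xs λ t → extend-swap _ ys zs)
                 (sym (extend-composeˡ h xs j zs i′ ys)))))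
      }

    open Operad FreeOperad using (Elt)

    gen : Fin k → Elt 1
    gen x = [ (1# , node x leaf leaf , ≡-refl) ]

    Presented : ∀ {r} → Pred (Elt 2) r → Operad a (a ⊔ ℓ₁ ⊔ r)
    Presented R = FreeOperad / ⟨ R ⟩

    -- In arity 3, `node x (node y leaf leaf) leaf` is `gen x ∘[ zero ] gen y` and
    -- `node x leaf (node y leaf leaf)` is `gen x ∘[ suc zero ] gen y`. The dual
    -- generators are indexed by `Fin k` as well, so both arguments are in `Tree k`.
    treePairing : Tree k → Tree k → K
    treePairing (node x (node y leaf leaf) leaf) (node x′ (node y′ leaf leaf) leaf) =
      if does (x ≟ᶠ x′) ∧ does (y ≟ᶠ y′) then 1# else 0#
    treePairing (node x leaf (node y leaf leaf)) (node x′ leaf (node y′ leaf leaf)) =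
      if does (x ≟ᶠ x′) ∧ does (y ≟ᶠ y′) then - 1# else 0#
    treePairing _ _ = 0#

    pairing : Elt 2 → Elt 2 → K
    pairing f r = extend (λ t → extend (λ s → treePairing (proj₁ t) (proj₁ s)) r) f

    Annihilator : ∀ {r} → Pred (Elt 2) r → Pred (Elt 2) (a ⊔ ℓ₁ ⊔ r)
    Annihilator R f = ∀ r → R r → pairing f r ≈ 0#

    KoszulDual : ∀ {r} → Pred (Elt 2) r → Operad a (a ⊔ ℓ₁ ⊔ r)
    KoszulDual R = Presented (Annihilator R)

  data Span {m ℓ s} (V : VectorSpace m ℓ) (S : Pred (LeftModule.Carrierᴹ V) s) :
            Pred (LeftModule.Carrierᴹ V) (a ⊔ m ⊔ ℓ ⊔ s) where
    generator : ∀ {x} → S x → Span V S x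
    resp      : ∀ {x y} → LeftModule._≈ᴹ_ V x y → Span V S x → Span V S y
    zeroᴹ     : Span V S (LeftModule.0ᴹ V)
    plus      : ∀ {x y} → Span V S x → Span V S y → Span V S (LeftModule._+ᴹ_ V x y)
    scale     : ∀ k {x} → Span V S x → Span V S (LeftModule._*ₗ_ V k x)

  module _ (c : ℕ) where

    open Operad (FreeOperad (suc c)) using (Elt; component; _∘[_]_; _-ᴹ_)

    _gen∘₁_ _gen∘₂_ : Fin (suc c) → Fin (suc c) → Elt 2
    x gen∘₁ y = gen (suc c) x ∘[ zero ] gen (suc c) y
    x gen∘₂ y = gen (suc c) x ∘[ suc zero ] gen (suc c) y

    data HiRelator : Pred (Elt 2) a where
      below : ∀ {x x′ b} → x ≤ᶠ b → x′ ≤ᶠ b → HiRelator ((x gen∘₁ b) -ᴹ (b gen∘₂ x′))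
      above : ∀ {x b} → x <ᶠ b → HiRelator ((b gen∘₁ x) -ᴹ (x gen∘₂ b))

    HiRelations : Pred (Elt 2) (a ⊔ ℓ₁)
    HiRelations = Span (component 2) HiRelator

    Hi : Operad a (a ⊔ ℓ₁)
    Hi = Presented (suc c) HiRelations

    Hi! : Operad a (a ⊔ ℓ₁)
    Hi! = KoszulDual (suc c) HiRelations

    K⋆ : Fin (suc c) → Operad.Elt Hi! 1
    K⋆ b = foldr _+ᴹ_ 0ᴹ (map (gen (suc c)) (filter (_≤ᶠ? b) (allFin (suc c))))
      where open Operad Hi! using (_+ᴹ_; 0ᴹ)

    data KRelator : Pred (Elt 2) a where
      relator : ∀ {x b} → x ≤ᶠ b → KRelator ((b gen∘₁ x) -ᴹ (x gen∘₂ b))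

    KPresented : Operad a (a ⊔ ℓ₁)
    KPresented = Presented (suc c) KRelator

{-# OPTIONS --safe #-}

-- Replacing E⋆_b by K⋆_b - K⋆_{b-1} is an invertible linear change of generators, so it
-- induces an automorphism of the free operad, and the two ideals have to be compared.
-- Write [u , v] for u ∘₁ v - v ∘₂ u. The element [K⋆_b , K⋆_a], a ≤ b, annihilates the
-- relations of Hi. Conversely, an element f that annihilates them is a sum of the terms
-- κ x y [E⋆_x , E⋆_y], where κ x y = κ y y for x ≤ y. For fixed y, writing κ x y as
-- (κ x y - κ y y) + κ y y leaves the terms [E⋆_x , E⋆_y] with x > y and the sum over all
-- x, which is [K⋆_c , E⋆_y]. All of these are combinations of [K⋆_b , K⋆_a] with a ≤ b.

module Submission where

open import Defs
open import Algebra.Apartness.Bundles using (HeytingField)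
open import Algebra.Bundles using (CommutativeRing)
import Algebra.Properties.Ring as RingProperties
open import Data.Bool.Base using (if_then_else_)
open import Data.Fin.Base using (Fin; zero; suc; toℕ; fromℕ; inject₁) renaming (_≤_ to _≤ᶠ_; _<_ to _<ᶠ_)
open import Data.Fin.Induction using (<-weakInduction)
open import Data.Fin.Properties using (toℕ-inject₁; toℕ-injective; ≤fromℕ)
  renaming (_≟_ to _≟ᶠ_; _≤?_ to _≤ᶠ?_)
open import Data.List.Base using (List; []; _∷_; _++_; [_]; map; foldr; filter; allFin)
open import Data.List.Properties using (map-tabulate)
open import Data.List.Relation.Unary.All as All using (All; []; _∷_)
open import Data.Nat.Base using (ℕ; suc; _∸_; z≤n; s≤s⁻¹) renaming (_+_ to _+ⁿ_; _≤_ to _≤ⁿ_)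
open import Data.Nat.Properties
  using (≰⇒>; ≤-refl; ≤-trans; ≤-reflexive; <-irrefl; <⇒≤; ≤∧≢⇒<; m≤n⇒m≤1+n; n≤1+n)
  renaming (_≤?_ to _≤ⁿ?_)
open import Data.Product.Base using (Σ-syntax; _,_; proj₁; proj₂; map₂)
open import Relation.Binary.PropositionalEquality
  using (_≡_; cong; cong₂; subst) renaming (refl to ≡-refl; sym to ≡-sym; trans to ≡-trans)
open import Relation.Nullary using (¬_; Dec; yes; no; does)
open import Relation.Nullary.Decidable using (dec-true; dec-false)

module _ {k : ℕ} where

  join : ∀ {m n} → Fin k → Tree[ k ] m → Tree[ k ] n → Tree[ k ] (suc (m +ⁿ n))
  join b (l , |l|) (r , |r|) = node b l r , cong suc (cong₂ _+ⁿ_ |l| |r|)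

module _ {a ℓ₁ ℓ₂} (𝕂 : HeytingField a ℓ₁ ℓ₂) where

  open CommutativeRing (scalars 𝕂) renaming (Carrier to K) hiding (zero)
  open RingProperties ring
    using (-1*x≈-x; -0#≈0#; -‿involutive; -‿distribˡ-*; x[y-z]≈xy-xz;
           x≈y⇒x∙y⁻¹≈ε; x∙y⁻¹≈ε⇒x≈y; //-rightDividesˡ)
  open import Relation.Binary.Reasoning.Setoid setoid

  -- Finite formal combinations evaluated against scalar functions

  ∑ : {B : Set} → Combination 𝕂 B → (B → K) → K
  ∑ xs h = extend 𝕂 h xs

  infix 5 ∑
  syntax ∑ xs (λ b → e) = ∑[ b ← xs ] e

  ∑-cong : ∀ {B : Set} {h h′ : B → K} xs → (∀ b → h b ≈ h′ b) → ∑ xs h ≈ ∑ xs h′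
  ∑-cong = extend-ext 𝕂

  ∑-swap : ∀ {B C : Set} {h : B → C → K} xs ys →
           (∑[ b ← xs ] ∑[ c ← ys ] h b c) ≈ (∑[ c ← ys ] ∑[ b ← xs ] h b c)
  ∑-swap = extend-swap 𝕂 _

  infixl 1 _>>=_
  -- The linear extension of `F` from basis elements to combinations.
  _>>=_ : {B C : Set} → Combination 𝕂 B → (B → Combination 𝕂 C) → Combination 𝕂 C
  []             >>= F = []
  ((k , b) ∷ xs) >>= F = scaleᶜ 𝕂 k (F b) ++ (xs >>= F)

  -- Combinations are compared through the functionals they induce, so this identity turns
  -- statements about `>>=` into rearrangements of iterated sums.
  ∑->>= : ∀ {B C : Set} {h : C → K} xs (F : B → Combination 𝕂 C) →
          ∑ (xs >>= F) h ≈ (∑[ b ← xs ] ∑ (F b) h)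
  ∑->>= []             F = refl
  ∑->>= ((k , b) ∷ xs) F = trans (extend-++ 𝕂 _ (scaleᶜ 𝕂 k (F b)) (xs >>= F))
    (+-cong (extend-scale 𝕂 _ k (F b)) (∑->>= xs F))

  -- The Iverson bracket, written with `does` so that it computes to the same conditionals as the
  -- tests inside `treePairing`.
  𝟏 : ∀ {p} {P : Set p} → Dec P → K
  𝟏 P? = if does P? then 1# else 0#

  𝟏-yes : ∀ {p} {P : Set p} (P? : Dec P) → P → 𝟏 P? ≈ 1#
  𝟏-yes P? p rewrite dec-true P? p = refl

  𝟏-no : ∀ {p} {P : Set p} (P? : Dec P) → ¬ P → 𝟏 P? ≈ 0#
  𝟏-no P? ¬p rewrite dec-false P? ¬p = refl

  𝟏-cong : ∀ {p q} {P : Set p} {Q : Set q} (P? : Dec P) (Q? : Dec Q) → (P → Q) → (Q → P) → 𝟏 P? ≈ 𝟏 Q?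
  𝟏-cong (yes p) Q? P⇒Q Q⇒P = sym (𝟏-yes Q? (P⇒Q p))
  𝟏-cong (no ¬p) Q? P⇒Q Q⇒P = sym (𝟏-no Q? λ q → ¬p (Q⇒P q))

  𝟏-≟-sym : ∀ {n} (x y : Fin n) → 𝟏 (x ≟ᶠ y) ≈ 𝟏 (y ≟ᶠ x)
  𝟏-≟-sym x y = 𝟏-cong (x ≟ᶠ y) (y ≟ᶠ x) ≡-sym ≡-sym

  ∑-*ʳ : ∀ {B : Set} (h : B → K) k xs → (∑[ b ← xs ] h b * k) ≈ ∑ xs h * k
  ∑-*ʳ h k xs = trans (∑-cong xs λ b → *-comm (h b) k) (trans (extend-* 𝕂 k h xs) (*-comm k _))

  ∑-- : ∀ {B : Set} (h h′ : B → K) xs → (∑[ b ← xs ] h b - h′ b) ≈ ∑ xs h - ∑ xs h′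
  ∑-- h h′ xs = trans (extend-+ 𝕂 h (λ b → - h′ b) xs) (+-congˡ (begin
    (∑[ b ← xs ] - h′ b)        ≈⟨ ∑-cong xs (λ b → sym (-1*x≈-x (h′ b))) ⟩
    (∑[ b ← xs ] - 1# * h′ b)   ≈⟨ extend-* 𝕂 (- 1#) h′ xs ⟩
    - 1# * ∑ xs h′              ≈⟨ -1*x≈-x _ ⟩
    - ∑ xs h′                   ∎))

  indicator : {B : Set} → List B → Combination 𝕂 B
  indicator = map (1# ,_)

  ∑-indicator-map : ∀ {B C : Set} (h : C → K) (f : B → C) xs →
                    ∑ (indicator (map f xs)) h ≈ (∑[ b ← indicator xs ] h (f b))
  ∑-indicator-map h f []       = refl
  ∑-indicator-map h f (x ∷ xs) = +-congˡ (∑-indicator-map h f xs)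

  ∑-indicator-filter : ∀ {B : Set} {p} {P : B → Set p} (P? : ∀ b → Dec (P b)) (h : B → K) xs →
                       ∑ (indicator (filter P? xs)) h ≈ (∑[ b ← indicator xs ] 𝟏 (P? b) * h b)
  ∑-indicator-filter P? h [] = refl
  ∑-indicator-filter P? h (x ∷ xs) with P? x
  ... | yes _ = +-cong (*-congˡ (sym (*-identityˡ (h x)))) (∑-indicator-filter P? h xs)
  ... | no  _ = trans (∑-indicator-filter P? h xs)
                      (sym (trans (+-congʳ (trans (*-congˡ (zeroˡ (h x))) (zeroʳ 1#))) (+-identityˡ _)))

  full : ∀ n → Combination 𝕂 (Fin n)
  full n = indicator (allFin n)

  ∑-full-suc : ∀ n (h : Fin (suc n) → K) → ∑ (full (suc n)) h ≈ h zero + (∑[ x ← full n ] h (suc x))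
  ∑-full-suc n h = +-cong (*-identityˡ (h zero)) (trans
    -- `allFin (suc n)` unfolds to `zero ∷ tabulate suc`; its tail is exhibited as the image of
    -- `allFin n` under `suc`.
    (reflexive (cong (λ xs → ∑ (indicator xs) h) (≡-sym (map-tabulate (λ x → x) suc))))
    (∑-indicator-map h suc (allFin n)))

  ∑-full-𝟏 : ∀ {n} (h : Fin n → K) y → (∑[ x ← full n ] 𝟏 (y ≟ᶠ x) * h x) ≈ h y
  ∑-full-𝟏 {suc n} h zero = begin
    (∑[ x ← full (suc n) ] 𝟏 (zero ≟ᶠ x) * h x)    ≈⟨ ∑-full-suc n _ ⟩
    1# * h zero + (∑[ x ← full n ] 0# * h (suc x)) ≈⟨ +-cong (*-identityˡ _)
      (trans (∑-cong (full n) (λ x → zeroˡ _)) (extend-0 𝕂 (full n))) ⟩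
    h zero + 0#                                    ≈⟨ +-identityʳ _ ⟩
    h zero                                         ∎
  ∑-full-𝟏 {suc n} h (suc y) = begin
    (∑[ x ← full (suc n) ] 𝟏 (suc y ≟ᶠ x) * h x)                ≈⟨ ∑-full-suc n _ ⟩
    -- The `does` of `suc y ≟ᶠ suc x` is that of `y ≟ᶠ x`, so the tail is the induction hypothesis
    -- for the shifted function.
    0# * h zero + (∑[ x ← full n ] 𝟏 (y ≟ᶠ x) * h (suc x))      ≈⟨ +-cong (zeroˡ _) (∑-full-𝟏 (λ x → h (suc x)) y) ⟩
    0# + h (suc y)                                              ≈⟨ +-identityˡ _ ⟩
    h (suc y)                                                   ∎

  -- With `M x` read as row `x` of a matrix, this is MN = 1. It is tested on every functional, so it
  -- applies directly inside iterated sums. It is one-sided, hence established below in both orders.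
  Inverses : ∀ {k} (M N : Fin k → Combination 𝕂 (Fin k)) → Set _
  Inverses {k} M N = ∀ (h : Fin k → K) x → (∑[ y ← M x ] ∑[ z ← N y ] h z) ≈ h x

  -- The change of generators

  module _ {c : ℕ} where

    -- The coordinates of K⋆_b over the generators E⋆_x.
    lower : Fin (suc c) → Combination 𝕂 (Fin (suc c))
    lower b = indicator (filter (_≤ᶠ? b) (allFin (suc c)))

    ∑-lower : ∀ (h : Fin (suc c) → K) b → ∑ (lower b) h ≈ (∑[ x ← full (suc c) ] 𝟏 (x ≤ᶠ? b) * h x)
    ∑-lower h b = ∑-indicator-filter (_≤ᶠ? b) h (allFin (suc c))

    ∑-lower-zero : ∀ (h : Fin (suc c) → K) → ∑ (lower zero) h ≈ h zero
    ∑-lower-zero h = trans (∑-lower h zero) (trans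
      (∑-cong (full (suc c)) λ x → *-congʳ (𝟏-cong (x ≤ᶠ? zero {c}) (zero ≟ᶠ x) (≤0⇒0≡ x) λ { ≡-refl → z≤n }))
      (∑-full-𝟏 h zero))
      where
      ≤0⇒0≡ : ∀ (x : Fin (suc c)) → x ≤ᶠ (zero {c}) → zero ≡ x
      ≤0⇒0≡ zero _ = ≡-refl

    ∑-lower-suc : ∀ (h : Fin (suc c) → K) b → ∑ (lower (suc b)) h ≈ h (suc b) + ∑ (lower (inject₁ b)) h
    ∑-lower-suc h b = begin
      ∑ (lower (suc b)) h
        ≈⟨ ∑-lower h (suc b) ⟩
      (∑[ x ← full (suc c) ] 𝟏 (x ≤ᶠ? suc b) * h x)
        ≈⟨ ∑-cong (full (suc c)) (λ x → trans (*-congʳ (split x)) (distribʳ (h x) _ _)) ⟩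
      (∑[ x ← full (suc c) ] 𝟏 (suc b ≟ᶠ x) * h x + 𝟏 (x ≤ᶠ? inject₁ b) * h x)
        ≈⟨ extend-+ 𝕂 _ _ (full (suc c)) ⟩
      (∑[ x ← full (suc c) ] 𝟏 (suc b ≟ᶠ x) * h x) + (∑[ x ← full (suc c) ] 𝟏 (x ≤ᶠ? inject₁ b) * h x)
        ≈⟨ +-cong (∑-full-𝟏 h (suc b)) (sym (∑-lower h (inject₁ b))) ⟩
      h (suc b) + ∑ (lower (inject₁ b)) h ∎
      where
      -- Either `x` is `suc b`, which exceeds its predecessor `inject₁ b`, or the bounds `suc b` and
      -- `inject₁ b` say the same about `x`.
      split : ∀ x → 𝟏 (x ≤ᶠ? suc b) ≈ 𝟏 (suc b ≟ᶠ x) + 𝟏 (x ≤ᶠ? inject₁ b)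
      split x with suc b ≟ᶠ x
      ... | yes ≡-refl = begin
        𝟏 (suc b ≤ᶠ? suc b)              ≈⟨ 𝟏-yes (suc b ≤ᶠ? suc b) (≤-refl {toℕ (suc b)}) ⟩
        1#                               ≈⟨ +-identityʳ 1# ⟨
        1# + 0#                          ≈⟨ +-congˡ (𝟏-no (suc b ≤ᶠ? inject₁ b) (<-irrefl (≡-sym (toℕ-inject₁ b)))) ⟨
        1# + 𝟏 (suc b ≤ᶠ? inject₁ b)     ∎
      ... | no b≢x = begin
        𝟏 (x ≤ᶠ? suc b)            ≈⟨ 𝟏-cong (x ≤ᶠ? suc b) (x ≤ᶠ? inject₁ b)
          (λ x≤ → subst (toℕ x ≤ⁿ_) (≡-sym (toℕ-inject₁ b))
                    (s≤s⁻¹ (≤∧≢⇒< x≤ λ eq → b≢x (≡-sym (toℕ-injective eq)))))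
          (λ x≤ → m≤n⇒m≤1+n (subst (toℕ x ≤ⁿ_) (toℕ-inject₁ b) x≤)) ⟩
        𝟏 (x ≤ᶠ? inject₁ b)        ≈⟨ +-identityˡ _ ⟨
        0# + 𝟏 (x ≤ᶠ? inject₁ b)   ∎

    ∑-lower-last : ∀ (h : Fin (suc c) → K) → ∑ (lower (fromℕ c)) h ≈ ∑ (full (suc c)) h
    ∑-lower-last h = trans (∑-lower h (fromℕ c))
      (∑-cong (full (suc c)) λ x → trans (*-congʳ (𝟏-yes (x ≤ᶠ? fromℕ c) (≤fromℕ x))) (*-identityˡ (h x)))

    -- The coefficient of E⋆_y in K⋆_b, in the shape in which the pairing with the relations of Hi
    -- produces it.
    lower⟨_⟩ : ∀ b y → (∑[ x ← lower b ] 𝟏 (x ≟ᶠ y)) ≈ 𝟏 (y ≤ᶠ? b)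
    lower⟨ b ⟩ y = trans (∑-lower (λ x → 𝟏 (x ≟ᶠ y)) b) (trans
      (∑-cong (full (suc c)) λ x → trans (*-comm _ _) (*-congʳ (𝟏-≟-sym x y)))
      (∑-full-𝟏 (λ x → 𝟏 (x ≤ᶠ? b)) y))

    Δ : Fin (suc c) → Combination 𝕂 (Fin (suc c))
    Δ zero    = [ 1# , zero ]
    Δ (suc b) = (1# , suc b) ∷ (- 1# , inject₁ b) ∷ []

    ∑-Δ-suc : ∀ (h : Fin (suc c) → K) b → ∑ (Δ (suc b)) h ≈ h (suc b) - h (inject₁ b)
    ∑-Δ-suc h b = +-cong (*-identityˡ _) (trans (+-identityʳ _) (-1*x≈-x _))

    -- Two consecutive partial sums differ by their last summand.
    Δ-lower : Inverses Δ lower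
    Δ-lower h zero    = trans (extend-singleton 𝕂 (λ y → ∑ (lower y) h) zero) (∑-lower-zero h)
    Δ-lower h (suc b) = begin
      (∑[ y ← Δ (suc b) ] ∑ (lower y) h)                        ≈⟨ ∑-Δ-suc (λ y → ∑ (lower y) h) b ⟩
      ∑ (lower (suc b)) h - ∑ (lower (inject₁ b)) h             ≈⟨ +-congʳ (∑-lower-suc h b) ⟩
      (h (suc b) + ∑ (lower (inject₁ b)) h) - ∑ (lower (inject₁ b)) h ≈⟨ +-assoc _ _ _ ⟩
      h (suc b) + (∑ (lower (inject₁ b)) h - ∑ (lower (inject₁ b)) h) ≈⟨ +-congˡ (-‿inverseʳ _) ⟩
      h (suc b) + 0#                                            ≈⟨ +-identityʳ _ ⟩
      h (suc b)                                                 ∎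

    -- A sum of consecutive differences telescopes, by induction on the upper bound.
    lower-Δ : Inverses lower Δ
    lower-Δ h = <-weakInduction (λ b → (∑[ y ← lower b ] ∑ (Δ y) h) ≈ h b)
      (trans (∑-lower-zero (λ y → ∑ (Δ y) h)) (extend-singleton 𝕂 h zero))
      λ b IH → begin
        (∑[ y ← lower (suc b) ] ∑ (Δ y) h)                          ≈⟨ ∑-lower-suc (λ y → ∑ (Δ y) h) b ⟩
        ∑ (Δ (suc b)) h + (∑[ y ← lower (inject₁ b) ] ∑ (Δ y) h)    ≈⟨ +-cong (∑-Δ-suc h b) IH ⟩
        (h (suc b) - h (inject₁ b)) + h (inject₁ b)                 ≈⟨ +-assoc _ _ _ ⟩
        h (suc b) + (- h (inject₁ b) + h (inject₁ b))               ≈⟨ +-congˡ (-‿inverseˡ _) ⟩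
        h (suc b) + 0#                                              ≈⟨ +-identityʳ _ ⟩
        h (suc b)                                                   ∎

    Δ-≤ : ∀ y → All (λ (_ , y′) → y′ ≤ᶠ y) (Δ y)
    Δ-≤ zero    = z≤n ∷ []
    Δ-≤ (suc y) = ≤-refl {toℕ (suc y)} ∷ ≤-trans (≤-reflexive (toℕ-inject₁ y)) (n≤1+n (toℕ y)) ∷ []

  -- Endomorphisms of the free operad that act linearly on the generators

  module Relabelling {k : ℕ} (M : Fin k → Combination 𝕂 (Fin k)) where

    -- Substitutes `M x` for every label `x`, multilinearly. Indexing the result by `size t` itself
    -- keeps the recursion free of transports.
    relabelᵗ : (t : Tree k) → Combination 𝕂 (Tree[ k ] (size t))
    relabelᵗ leaf         = [ 1# , leaf , ≡-refl ]
    relabelᵗ (node x l r) = M x >>= λ y → bilinear 𝕂 (join y) (relabelᵗ l) (relabelᵗ r)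

    ∑-relabelᵗ-node : ∀ x l r h → ∑ (relabelᵗ (node x l r)) h ≈
      (∑[ y ← M x ] ∑[ l′ ← relabelᵗ l ] ∑[ r′ ← relabelᵗ r ] h (join y l′ r′))
    ∑-relabelᵗ-node x l r h = trans (∑->>= (M x) _)
      (∑-cong (M x) λ y → extend-bilinear 𝕂 (join y) h (relabelᵗ l) (relabelᵗ r))

    -- Relabelling keeps the shape, so a graft enters the same subtree before and after it. The
    -- functional lives on bare trees because the sizes of the two sides agree only propositionally.
    relabelᵗ-graft : ∀ (h : Tree k → K) t i s →
      (∑[ u ← relabelᵗ (graft t i s) ] h (proj₁ u)) ≈
      (∑[ t′ ← relabelᵗ t ] ∑[ s′ ← relabelᵗ s ] h (graft (proj₁ t′) i (proj₁ s′)))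
    relabelᵗ-graft h leaf i s = sym (extend-singleton 𝕂 {Tree[ k ] 0}
      (λ t′ → ∑[ s′ ← relabelᵗ s ] h (graft (proj₁ t′) i (proj₁ s′))) (leaf , ≡-refl))
    relabelᵗ-graft h (node x l r) i s with i ≤ⁿ? size l
    ... | yes i≤l = begin
      (∑[ u ← relabelᵗ (graft (node x l r) i s) ] h (proj₁ u))
        ≡⟨ cong (λ t → ∑[ u ← relabelᵗ t ] h (proj₁ u)) (graft-left l r s i≤l) ⟩
      (∑[ u ← relabelᵗ (node x (graft l i s) r) ] h (proj₁ u))
        ≈⟨ ∑-relabelᵗ-node x (graft l i s) r (λ u → h (proj₁ u)) ⟩
      (∑[ y ← M x ] ∑[ l′ ← relabelᵗ (graft l i s) ] ∑[ r′ ← relabelᵗ r ] h (node y (proj₁ l′) (proj₁ r′)))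
        ≈⟨ ∑-cong (M x) (λ y → trans
             -- The right subtree is a spectator: its sum is absorbed into the functional for the
             -- recursive call and then moved outside the sum over `s′`.
             (relabelᵗ-graft (λ l′ → ∑[ r′ ← relabelᵗ r ] h (node y l′ (proj₁ r′))) l i s)
             (∑-cong (relabelᵗ l) λ l′ → trans (∑-swap (relabelᵗ s) (relabelᵗ r))
               (∑-cong (relabelᵗ r) λ r′ → ∑-cong (relabelᵗ s) λ s′ → reflexive (cong h (≡-sym
                 (graft-left (proj₁ l′) (proj₁ r′) (proj₁ s′) (≤-trans i≤l (≤-reflexive (≡-sym (proj₂ l′)))))))))) ⟩
      (∑[ y ← M x ] ∑[ l′ ← relabelᵗ l ] ∑[ r′ ← relabelᵗ r ] ∑[ s′ ← relabelᵗ s ]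
        h (graft (node y (proj₁ l′) (proj₁ r′)) i (proj₁ s′)))
        ≈⟨ ∑-relabelᵗ-node x l r (λ t′ → ∑[ s′ ← relabelᵗ s ] h (graft (proj₁ t′) i (proj₁ s′))) ⟨
      (∑[ t′ ← relabelᵗ (node x l r) ] ∑[ s′ ← relabelᵗ s ] h (graft (proj₁ t′) i (proj₁ s′))) ∎
    ... | no i≰l = begin
      (∑[ u ← relabelᵗ (graft (node x l r) i s) ] h (proj₁ u))
        ≡⟨ cong (λ t → ∑[ u ← relabelᵗ t ] h (proj₁ u)) (graft-right l r s (≰⇒> i≰l)) ⟩
      (∑[ u ← relabelᵗ (node x l (graft r j s)) ] h (proj₁ u))
        ≈⟨ ∑-relabelᵗ-node x l (graft r j s) (λ u → h (proj₁ u)) ⟩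
      (∑[ y ← M x ] ∑[ l′ ← relabelᵗ l ] ∑[ r′ ← relabelᵗ (graft r j s) ] h (node y (proj₁ l′) (proj₁ r′)))
        ≈⟨ ∑-cong (M x) (λ y → ∑-cong (relabelᵗ l) λ l′ → trans
             (relabelᵗ-graft (λ r′ → h (node y (proj₁ l′) r′)) r j s)
             (∑-cong (relabelᵗ r) λ r′ → ∑-cong (relabelᵗ s) λ s′ →
               reflexive (cong h (≡-sym (≡-trans
                 -- `graft-right` shifts the position by the size of `l′`, which `proj₂ l′`
                 -- identifies with the size of `l`.
                 (graft-right (proj₁ l′) (proj₁ r′) (proj₁ s′) (≤-trans (≤-reflexive (cong suc (proj₂ l′))) (≰⇒> i≰l)))
                 (cong (λ m → node y (proj₁ l′) (graft (proj₁ r′) (i ∸ suc m) (proj₁ s′))) (proj₂ l′))))))) ⟩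
      (∑[ y ← M x ] ∑[ l′ ← relabelᵗ l ] ∑[ r′ ← relabelᵗ r ] ∑[ s′ ← relabelᵗ s ]
        h (graft (node y (proj₁ l′) (proj₁ r′)) i (proj₁ s′)))
        ≈⟨ ∑-relabelᵗ-node x l r (λ t′ → ∑[ s′ ← relabelᵗ s ] h (graft (proj₁ t′) i (proj₁ s′))) ⟨
      (∑[ t′ ← relabelᵗ (node x l r) ] ∑[ s′ ← relabelᵗ s ] h (graft (proj₁ t′) i (proj₁ s′))) ∎
      where j = i ∸ suc (size l)

    relabelᵍ : ∀ {n} → Tree[ k ] n → Combination 𝕂 (Tree[ k ] n)
    relabelᵍ (t , ≡-refl) = relabelᵗ t

    ∑-relabelᵍ : ∀ {n} (h : Tree k → K) (t : Tree[ k ] n) →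
      (∑[ u ← relabelᵍ t ] h (proj₁ u)) ≈ (∑[ u ← relabelᵗ (proj₁ t) ] h (proj₁ u))
    ∑-relabelᵍ h (t , ≡-refl) = refl

    relabelᵍ-⊲ : ∀ {n p} (h : Tree k → K) (t : Tree[ k ] n) i (s : Tree[ k ] p) →
      (∑[ u ← relabelᵍ (t ⊲[ i ] s) ] h (proj₁ u)) ≈
      (∑[ t′ ← relabelᵍ t ] ∑[ s′ ← relabelᵍ s ] h (proj₁ (t′ ⊲[ i ] s′)))
    relabelᵍ-⊲ h (t , ≡-refl) i (s , ≡-refl) =
      trans (∑-relabelᵍ h ((t , ≡-refl) ⊲[ i ] (s , ≡-refl))) (relabelᵗ-graft h t (toℕ i) s)

    relabel : ∀ {n} → Combination 𝕂 (Tree[ k ] n) → Combination 𝕂 (Tree[ k ] n)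
    relabel xs = xs >>= relabelᵍ

  module _ {k : ℕ} where

    open Operad (FreeOperad 𝕂 k)
    open module Free {n} = FreeVectorSpace 𝕂 (_≟_ {k} {n}) using (equal; ≋⇒extend)

    -- `_≟_` only compares the underlying trees, so functionals on `Tree k` suffice.
    ∑⇒≈ᴹ : ∀ {n} {xs ys : Elt n} →
           (∀ (h : Tree k → K) → (∑[ t ← xs ] h (proj₁ t)) ≈ (∑[ t ← ys ] h (proj₁ t))) → xs ≈ᴹ ys
    ∑⇒≈ᴹ eq = equal λ b → eq (λ t → if does (proj₁ b ≟ᵗ t) then 1# else 0#)

    >>=-congˡ : ∀ {m n} {xs ys : Elt m} (F : Tree[ k ] m → Elt n) → xs ≈ᴹ ys → (xs >>= F) ≈ᴹ (ys >>= F)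
    >>=-congˡ {xs = xs} {ys} F xs≈ys = ∑⇒≈ᴹ λ h →
      trans (∑->>= xs F) (trans (≋⇒extend _ xs≈ys) (sym (∑->>= ys F)))

    >>=-+ : ∀ {m n} (xs ys : Elt m) (F : Tree[ k ] m → Elt n) → (xs ++ ys >>= F) ≈ᴹ (xs >>= F) +ᴹ (ys >>= F)
    >>=-+ xs ys F = ∑⇒≈ᴹ λ h → begin
      _ ≈⟨ ∑->>= (xs ++ ys) F ⟩
      _ ≈⟨ extend-++ 𝕂 _ xs ys ⟩
      _ ≈⟨ +-cong (∑->>= xs F) (∑->>= ys F) ⟨
      _ ≈⟨ extend-++ 𝕂 _ (xs >>= F) (ys >>= F) ⟨
      _ ∎

    >>=-* : ∀ {m n} c (xs : Elt m) (F : Tree[ k ] m → Elt n) → (c *ₗ xs >>= F) ≈ᴹ c *ₗ (xs >>= F)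
    >>=-* c xs F = ∑⇒≈ᴹ λ h → begin
      _ ≈⟨ ∑->>= (c *ₗ xs) F ⟩
      _ ≈⟨ extend-scale 𝕂 _ c xs ⟩
      _ ≈⟨ *-congˡ (∑->>= xs F) ⟨
      _ ≈⟨ extend-scale 𝕂 _ c (xs >>= F) ⟨
      _ ∎

    >>=-- : ∀ {m n} (xs : Elt m) (F : Tree[ k ] m → Elt n) → ((-ᴹ xs) >>= F) ≈ᴹ -ᴹ (xs >>= F)
    >>=-- xs F = ∑⇒≈ᴹ λ h → begin
      _ ≈⟨ ∑->>= (-ᴹ xs) F ⟩
      _ ≈⟨ extend-neg 𝕂 _ xs ⟩
      _ ≈⟨ -‿cong (∑->>= xs F) ⟨
      _ ≈⟨ extend-neg 𝕂 _ (xs >>= F) ⟨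
      _ ∎

    module _ (M : Fin k → Combination 𝕂 (Fin k)) where

      open Relabelling M

      relabel-𝟙 : relabel 𝟙 ≈ᴹ 𝟙
      relabel-𝟙 = ∑⇒≈ᴹ λ h → trans (∑->>= {h = λ u → h (proj₁ u)} 𝟙 relabelᵍ)
        (extend-singleton 𝕂 {Tree[ k ] 0} (λ t → ∑[ u ← relabelᵍ t ] h (proj₁ u)) (leaf , ≡-refl))

      relabel-∘ : ∀ {n p} (xs : Elt n) i (ys : Elt p) →
                  relabel (xs ∘[ i ] ys) ≈ᴹ relabel xs ∘[ i ] relabel ys
      relabel-∘ xs i ys = ∑⇒≈ᴹ λ h → begin
        (∑[ u ← relabel (xs ∘[ i ] ys) ] h (proj₁ u))
          ≈⟨ ∑->>= (xs ∘[ i ] ys) relabelᵍ ⟩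
        (∑[ w ← xs ∘[ i ] ys ] ∑[ u ← relabelᵍ w ] h (proj₁ u))
          ≈⟨ extend-compose 𝕂 k _ xs i ys ⟩
        (∑[ t ← xs ] ∑[ s ← ys ] ∑[ u ← relabelᵍ (t ⊲[ i ] s) ] h (proj₁ u))
          -- After the statement for single trees, the interchange makes the sums over `s` and `s′`
          -- adjacent, so that they fold into a sum over `relabel ys`.
          ≈⟨ ∑-cong xs (λ t → trans (∑-cong ys λ s → relabelᵍ-⊲ h t i s) (∑-swap ys (relabelᵍ t))) ⟩
        (∑[ t ← xs ] ∑[ t′ ← relabelᵍ t ] ∑[ s ← ys ] ∑[ s′ ← relabelᵍ s ] h (proj₁ (t′ ⊲[ i ] s′)))
          ≈⟨ ∑-cong xs (λ t → ∑-cong (relabelᵍ t) λ t′ → ∑->>= ys relabelᵍ) ⟨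
        (∑[ t ← xs ] ∑[ t′ ← relabelᵍ t ] ∑[ s′ ← relabel ys ] h (proj₁ (t′ ⊲[ i ] s′)))
          ≈⟨ ∑->>= xs relabelᵍ ⟨
        (∑[ t′ ← relabel xs ] ∑[ s′ ← relabel ys ] h (proj₁ (t′ ⊲[ i ] s′)))
          ≈⟨ extend-compose 𝕂 k _ (relabel xs) i (relabel ys) ⟨
        (∑[ u ← relabel xs ∘[ i ] relabel ys ] h (proj₁ u)) ∎

      -- Relabelling is linear and commutes with composition, so it respects every closure rule of a
      -- generated ideal and only the generators need checking.
      relabel-Generated : ∀ {d s s′} {S : Elt d → Set s} {S′ : Elt d → Set s′} →
        (∀ {x} → S x → Generated 𝕂 (FreeOperad 𝕂 k) S′ (relabel x)) →
        ∀ {n} {x : Elt n} → Generated 𝕂 (FreeOperad 𝕂 k) S x → Generated 𝕂 (FreeOperad 𝕂 k) S′ (relabel x)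
      relabel-Generated {S = S} {S′} S⇒S′ = go
        where
        go : ∀ {n} {x : Elt n} → Generated 𝕂 (FreeOperad 𝕂 k) S x → Generated 𝕂 (FreeOperad 𝕂 k) S′ (relabel x)
        go (generator x∈S)         = S⇒S′ x∈S
        go (≈-mem x≈y x∈)          = ≈-mem (>>=-congˡ relabelᵍ x≈y) (go x∈)
        go 0-mem                   = 0-mem
        go (+-mem {x = x} {y} x∈ y∈) = ≈-mem (≈ᴹ-sym (>>=-+ x y relabelᵍ)) (+-mem (go x∈) (go y∈))
        go (*-mem c {x} x∈)        = ≈-mem (≈ᴹ-sym (>>=-* c x relabelᵍ)) (*-mem c (go x∈))
        go (mem-∘ {x = x} i y x∈)  = ≈-mem (≈ᴹ-sym (relabel-∘ x i y)) (mem-∘ i (relabel y) (go x∈))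
        go (∘-mem x i {y} y∈)      = ≈-mem (≈ᴹ-sym (relabel-∘ x i y)) (∘-mem (relabel x) i (go y∈))

    module _ {M N : Fin k → Combination 𝕂 (Fin k)} (MN≈1 : Inverses M N) where

      private
        module M = Relabelling M
        module N = Relabelling N

      -- Induction on the tree: the subtrees return to themselves by the induction hypotheses and
      -- the root label by MN = 1.
      relabelᵗ-inverse : ∀ (h : Tree k → K) t →
        (∑[ t′ ← M.relabelᵗ t ] ∑[ t″ ← N.relabelᵗ (proj₁ t′) ] h (proj₁ t″)) ≈ h t
      relabelᵗ-inverse h leaf = trans
        (extend-singleton 𝕂 {Tree[ k ] 0} (λ t′ → ∑[ t″ ← N.relabelᵗ (proj₁ t′) ] h (proj₁ t″)) (leaf , ≡-refl))
        (extend-singleton 𝕂 {Tree[ k ] 0} (λ t′ → h (proj₁ t′)) (leaf , ≡-refl))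
      relabelᵗ-inverse h (node x l r) = begin
        (∑[ t′ ← M.relabelᵗ (node x l r) ] ∑[ t″ ← N.relabelᵗ (proj₁ t′) ] h (proj₁ t″))
          ≈⟨ M.∑-relabelᵗ-node x l r (λ t′ → ∑[ t″ ← N.relabelᵗ (proj₁ t′) ] h (proj₁ t″)) ⟩
        (∑[ y ← M x ] ∑[ l′ ← M.relabelᵗ l ] ∑[ r′ ← M.relabelᵗ r ]
          ∑[ t″ ← N.relabelᵗ (node y (proj₁ l′) (proj₁ r′)) ] h (proj₁ t″))
          -- The right subtree is collapsed first, with the left one fixed; the left subtree and the
          -- label follow.
          ≈⟨ ∑-cong (M x) (λ y → ∑-cong (M.relabelᵗ l) λ l′ → onRight y (proj₁ l′)) ⟩
        (∑[ y ← M x ] ∑[ l′ ← M.relabelᵗ l ] ∑[ z ← N y ] ∑[ l″ ← N.relabelᵗ (proj₁ l′) ] h (node z (proj₁ l″) r))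
          ≈⟨ ∑-cong (M x) (λ y → trans (∑-swap (M.relabelᵗ l) (N y))
               (∑-cong (N y) λ z → relabelᵗ-inverse (λ l″ → h (node z l″ r)) l)) ⟩
        (∑[ y ← M x ] ∑[ z ← N y ] h (node z l r))
          ≈⟨ MN≈1 (λ z → h (node z l r)) x ⟩
        h (node x l r) ∎
        where
        onRight : ∀ y l′ →
          (∑[ r′ ← M.relabelᵗ r ] ∑[ t″ ← N.relabelᵗ (node y l′ (proj₁ r′)) ] h (proj₁ t″)) ≈
          (∑[ z ← N y ] ∑[ l″ ← N.relabelᵗ l′ ] h (node z (proj₁ l″) r))
        onRight y l′ = begin
          (∑[ r′ ← M.relabelᵗ r ] ∑[ t″ ← N.relabelᵗ (node y l′ (proj₁ r′)) ] h (proj₁ t″))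
            ≈⟨ ∑-cong (M.relabelᵗ r) (λ r′ → N.∑-relabelᵗ-node y l′ (proj₁ r′) (λ t″ → h (proj₁ t″))) ⟩
          (∑[ r′ ← M.relabelᵗ r ] ∑[ z ← N y ] ∑[ l″ ← N.relabelᵗ l′ ] ∑[ r″ ← N.relabelᵗ (proj₁ r′) ]
            h (node z (proj₁ l″) (proj₁ r″)))
            ≈⟨ trans (∑-swap (M.relabelᵗ r) (N y)) (∑-cong (N y) λ z → ∑-swap (M.relabelᵗ r) (N.relabelᵗ l′)) ⟩
          (∑[ z ← N y ] ∑[ l″ ← N.relabelᵗ l′ ] ∑[ r′ ← M.relabelᵗ r ] ∑[ r″ ← N.relabelᵗ (proj₁ r′) ]
            h (node z (proj₁ l″) (proj₁ r″)))
            ≈⟨ ∑-cong (N y) (λ z → ∑-cong (N.relabelᵗ l′) λ l″ →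
                 relabelᵗ-inverse (λ r″ → h (node z (proj₁ l″) r″)) r) ⟩
          (∑[ z ← N y ] ∑[ l″ ← N.relabelᵗ l′ ] h (node z (proj₁ l″) r)) ∎

      relabelᵍ-inverse : ∀ {n} (h : Tree k → K) (t : Tree[ k ] n) →
        (∑[ t′ ← M.relabelᵍ t ] ∑[ t″ ← N.relabelᵍ t′ ] h (proj₁ t″)) ≈ h (proj₁ t)
      relabelᵍ-inverse h (t , ≡-refl) =
        trans (∑-cong (M.relabelᵗ t) (N.∑-relabelᵍ h)) (relabelᵗ-inverse h t)

      relabel-inverse : ∀ {n} (xs : Elt n) → N.relabel (M.relabel xs) ≈ᴹ xs
      relabel-inverse xs = ∑⇒≈ᴹ λ h → begin
        (∑[ u ← N.relabel (M.relabel xs) ] h (proj₁ u))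
          ≈⟨ ∑->>= (M.relabel xs) N.relabelᵍ ⟩
        (∑[ t′ ← M.relabel xs ] ∑[ t″ ← N.relabelᵍ t′ ] h (proj₁ t″))
          ≈⟨ ∑->>= xs M.relabelᵍ ⟩
        (∑[ t ← xs ] ∑[ t′ ← M.relabelᵍ t ] ∑[ t″ ← N.relabelᵍ t′ ] h (proj₁ t″))
          ≈⟨ ∑-cong xs (relabelᵍ-inverse h) ⟩
        (∑[ t ← xs ] h (proj₁ t)) ∎

    -- Isomorphisms between quotients of the free operad

    module _ {M N : Fin k → Combination 𝕂 (Fin k)} (MN≈1 : Inverses M N) (NM≈1 : Inverses N M)
             {s s′} {S : Elt 2 → Set s} {S′ : Elt 2 → Set s′}
             (S⇒S′ : ∀ {x} → S x → Generated 𝕂 (FreeOperad 𝕂 k) S′ (Relabelling.relabel M x))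
             (S′⇒S : ∀ {x} → S′ x → Generated 𝕂 (FreeOperad 𝕂 k) S (Relabelling.relabel N x)) where

      private
        module M = Relabelling M
        module N = Relabelling N
        F/S  = Presented 𝕂 k S
        F/S′ = Presented 𝕂 k S′

      relabel-congruent : ∀ {n} {x y : Elt n} →
                          Operad._≈ᴹ_ F/S x y → Operad._≈ᴹ_ F/S′ (M.relabel x) (M.relabel y)
      relabel-congruent {x = x} {y} (congruent d) = congruent (≈-mem
        (≈ᴹ-trans (>>=-+ x (-ᴹ y) M.relabelᵍ) (+ᴹ-congˡ {x = M.relabel x} (>>=-- y M.relabelᵍ)))
        (relabel-Generated M S⇒S′ d))

      -- `N` carries the difference of the two images back into the ideal of `S`, where MN = 1
      -- identifies it with `x -ᴹ y`.
      relabel-injective : ∀ {n} {x y : Elt n} →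
                          Operad._≈ᴹ_ F/S′ (M.relabel x) (M.relabel y) → Operad._≈ᴹ_ F/S x y
      relabel-injective {x = x} {y} (congruent d) = congruent (≈-mem
        (≈ᴹ-trans (>>=-+ (M.relabel x) (-ᴹ M.relabel y) N.relabelᵍ) (+ᴹ-cong (relabel-inverse MN≈1 x)
          (≈ᴹ-trans (>>=-- (M.relabel y) N.relabelᵍ) (-ᴹ‿cong (relabel-inverse MN≈1 y)))))
        (relabel-Generated N S′⇒S d))

      relabel-≅ : _≅_ 𝕂 F/S F/S′
      relabel-≅ = record
        { to     = M.relabel
        ; linear = λ n → record
          { isLeftModuleMonomorphism = record
            { isLeftModuleHomomorphism = record
              { +ᴹ-isGroupHomomorphism = record
                { isMonoidHomomorphism = record
                  { isMagmaHomomorphism = record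
                    { isRelHomomorphism = record { cong = relabel-congruent }
                    ; homo = λ x y → lift (>>=-+ x y M.relabelᵍ)
                    }
                  ; ε-homo = lift ≈ᴹ-refl
                  }
                ; ⁻¹-homo = λ x → lift (>>=-- x M.relabelᵍ)
                }
              ; *ₗ-homo = λ c x → lift (>>=-* c x M.relabelᵍ)
              }
            ; injective = relabel-injective
            }
          -- The preimage of `y` is its relabelling by `N`; this is where NM = 1 enters.
          ; surjective = λ y → N.relabel y , λ z≈ → Operad.≈ᴹ-trans F/S′ (relabel-congruent z≈)
              (lift (relabel-inverse NM≈1 y))
          }
        ; 𝟙-homo = lift (relabel-𝟙 M)
        ; ∘-homo = λ x i y → lift (relabel-∘ M x i y)
        }
        where
        lift : ∀ {n} {x y : Elt n} → x ≈ᴹ y → Operad._≈ᴹ_ F/S′ x y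
        lift = ≈⇒Congruent 𝕂 (FreeOperad 𝕂 k) (⟨_⟩ 𝕂 S′)

    -- The component of arity 3

    -- The two shapes of basis trees in arity 3, those of `gen x ∘[ zero ] gen y` and
    -- `gen x ∘[ suc zero ] gen y`.
    left right : Fin k → Fin k → Tree k
    left  x y = node x (node y leaf leaf) leaf
    right x y = node x leaf (node y leaf leaf)

    corolla : Fin k → Tree[ k ] 1
    corolla x = node x leaf leaf , ≡-refl

    spread : Combination 𝕂 (Fin k) → Elt 1
    spread = map (map₂ corolla)

    ∑-spread : ∀ (h : Tree[ k ] 1 → K) u → ∑ (spread u) h ≈ (∑[ x ← u ] h (corolla x))
    ∑-spread h []            = refl
    ∑-spread h ((c , x) ∷ u) = +-congˡ (∑-spread h u)

    -- The element [u , v] of the overview. A `KRelator` is, definitionally, the bracket of two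
    -- generators.
    bracket : Elt 1 → Elt 1 → Elt 2
    bracket u v = u ∘[ zero ] v -ᴹ v ∘[ suc zero ] u

    bracket-cong : ∀ {u u′ v v′} → u ≈ᴹ u′ → v ≈ᴹ v′ → bracket u v ≈ᴹ bracket u′ v′
    bracket-cong u≈ v≈ = +ᴹ-cong (∘-cong zero u≈ v≈) (-ᴹ‿cong (∘-cong (suc zero) v≈ u≈))

    ∑-bracket-spread : ∀ (h : Tree k → K) u v →
      (∑[ t ← bracket (spread u) (spread v) ] h (proj₁ t)) ≈ (∑[ x ← u ] ∑[ y ← v ] h (left x y) - h (right y x))
    ∑-bracket-spread h u v = begin
      (∑[ t ← bracket û v̂ ] h (proj₁ t))
        ≈⟨ trans (extend-++ 𝕂 _ (û ∘[ zero ] v̂) (-ᴹ (v̂ ∘[ suc zero ] û)))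
             (+-congˡ (extend-neg 𝕂 _ (v̂ ∘[ suc zero ] û))) ⟩
      (∑[ t ← û ∘[ zero ] v̂ ] h (proj₁ t)) - (∑[ t ← v̂ ∘[ suc zero ] û ] h (proj₁ t))
        ≈⟨ +-cong (extend-compose 𝕂 k _ û zero v̂)
             -- The second composite has `v̂` as its outer factor; the interchange aligns the order
             -- of summation with the first one.
             (-‿cong (trans (extend-compose 𝕂 k _ v̂ (suc zero) û) (∑-swap v̂ û))) ⟩
      (∑[ t ← û ] ∑[ s ← v̂ ] h (proj₁ (t ⊲[ zero ] s))) - (∑[ t ← û ] ∑[ s ← v̂ ] h (proj₁ (s ⊲[ suc zero ] t)))
        ≈⟨ +-cong (double _) (-‿cong (double _)) ⟩
      (∑[ x ← u ] ∑[ y ← v ] h (left x y)) - (∑[ x ← u ] ∑[ y ← v ] h (right y x))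
        ≈⟨ ∑-- _ _ u ⟨
      (∑[ x ← u ] ∑ v (λ y → h (left x y)) - ∑ v (λ y → h (right y x)))
        ≈⟨ ∑-cong u (λ x → ∑-- _ _ v) ⟨
      (∑[ x ← u ] ∑[ y ← v ] h (left x y) - h (right y x)) ∎
      where
      û = spread u
      v̂ = spread v
      double : ∀ (g : Tree[ k ] 1 → Tree[ k ] 1 → K) →
               (∑[ t ← û ] ∑[ s ← v̂ ] g t s) ≈ (∑[ x ← u ] ∑[ y ← v ] g (corolla x) (corolla y))
      double g = trans (∑-spread _ u) (∑-cong u λ x → ∑-spread _ v)

    >>=-assoc : ∀ {B : Set} {m n} (xs : Combination 𝕂 B) (F : B → Elt m) (G : Tree[ k ] m → Elt n) →
                ((xs >>= F) >>= G) ≈ᴹ (xs >>= λ b → F b >>= G)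
    >>=-assoc xs F G = ∑⇒≈ᴹ λ h → begin
      _ ≈⟨ ∑->>= (xs >>= F) G ⟩
      _ ≈⟨ ∑->>= xs F ⟩
      _ ≈⟨ ∑-cong xs (λ b → ∑->>= (F b) G) ⟨
      _ ≈⟨ ∑->>= xs (λ b → F b >>= G) ⟨
      _ ∎

    >>=-congʳ : ∀ {B : Set} {n} (xs : Combination 𝕂 B) {F G : B → Elt n} →
                (∀ b → F b ≈ᴹ G b) → (xs >>= F) ≈ᴹ (xs >>= G)
    >>=-congʳ []             F≈G = ≈ᴹ-refl
    >>=-congʳ ((c , b) ∷ xs) F≈G = +ᴹ-cong (*ₗ-congˡ (F≈G b)) (>>=-congʳ xs F≈G)

    >>=-mem : ∀ {B : Set} {n d s} {S : Elt d → Set s} {F : B → Elt n} {xs : Combination 𝕂 B} →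
              All (λ (_ , b) → Generated 𝕂 (FreeOperad 𝕂 k) S (F b)) xs →
              Generated 𝕂 (FreeOperad 𝕂 k) S (xs >>= F)
    >>=-mem []                        = 0-mem
    >>=-mem {xs = (c , _) ∷ _} (m ∷ ms) = +-mem (*-mem c m) (>>=-mem ms)

    -- Bilinearity, in the form that reduces ideal membership of a bracket to brackets of
    -- generators.
    bracket-spread : ∀ u v → bracket (spread u) (spread v) ≈ᴹ
      (u >>= λ x → v >>= λ y → bracket (gen 𝕂 k x) (gen 𝕂 k y))
    bracket-spread u v = ∑⇒≈ᴹ λ h → begin
      _ ≈⟨ ∑-bracket-spread h u v ⟩
      (∑[ x ← u ] ∑[ y ← v ] h (left x y) - h (right y x))
        ≈⟨ ∑-cong u (λ x → ∑-cong v λ y → trans (∑-bracket-spread h [ 1# , x ] [ 1# , y ]) (trans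
             (extend-singleton 𝕂 (λ x → ∑[ y ← [ 1# , y ] ] h (left x y) - h (right y x)) x)
             (extend-singleton 𝕂 (λ y → h (left x y) - h (right y x)) y))) ⟨
      (∑[ x ← u ] ∑[ y ← v ] ∑[ t ← bracket (gen 𝕂 k x) (gen 𝕂 k y) ] h (proj₁ t))
        ≈⟨ ∑-cong u (λ x → ∑->>= v _) ⟨
      _ ≈⟨ ∑->>= u _ ⟨
      _ ∎

    relabel-gen : ∀ M x → Relabelling.relabel M (gen 𝕂 k x) ≈ᴹ spread (M x)
    relabel-gen M x = ∑⇒≈ᴹ λ h → begin
      (∑[ u ← relabel (gen 𝕂 k x) ] h (proj₁ u))
        ≈⟨ ∑->>= {h = λ u → h (proj₁ u)} (gen 𝕂 k x) relabelᵍ ⟩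
      (∑[ t ← gen 𝕂 k x ] ∑[ u ← relabelᵍ t ] h (proj₁ u))
        ≈⟨ extend-singleton 𝕂 (λ t → ∑[ u ← relabelᵍ t ] h (proj₁ u)) (corolla x) ⟩
      (∑[ u ← relabelᵗ (node x leaf leaf) ] h (proj₁ u))
        ≈⟨ ∑-relabelᵗ-node x leaf leaf (λ u → h (proj₁ u)) ⟩
      (∑[ y ← M x ] ∑[ l ← 𝟙 ] ∑[ r ← 𝟙 ] h (node y (proj₁ l) (proj₁ r)))
        ≈⟨ ∑-cong (M x) (λ y → trans
             (extend-singleton 𝕂 {Tree[ k ] 0} (λ l → ∑[ r ← 𝟙 ] h (node y (proj₁ l) (proj₁ r))) (leaf , ≡-refl))
             (extend-singleton 𝕂 {Tree[ k ] 0} (λ r → h (node y leaf (proj₁ r))) (leaf , ≡-refl))) ⟩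
      (∑[ y ← M x ] h (node y leaf leaf))
        ≈⟨ ∑-spread (λ u → h (proj₁ u)) (M x) ⟨
      (∑[ u ← spread (M x) ] h (proj₁ u)) ∎
      where open Relabelling M

    relabel-bracket : ∀ M x y →
      Relabelling.relabel M (bracket (gen 𝕂 k x) (gen 𝕂 k y)) ≈ᴹ bracket (spread (M x)) (spread (M y))
    relabel-bracket M x y = ≈ᴹ-trans (>>=-+ (gx ∘[ zero ] gy) (-ᴹ (gy ∘[ suc zero ] gx)) relabelᵍ)
      (≈ᴹ-trans (+ᴹ-cong (relabel-∘ M gx zero gy)
                  (≈ᴹ-trans (>>=-- (gy ∘[ suc zero ] gx) relabelᵍ) (-ᴹ‿cong (relabel-∘ M gy (suc zero) gx))))
                (bracket-cong (relabel-gen M x) (relabel-gen M y)))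
      where
      open Relabelling M
      gx = gen 𝕂 k x
      gy = gen 𝕂 k y

    -- The pairing in arity 3 and the coordinates it gives

    Span-∑≈0 : ∀ {n s} {S : Elt n → Set s} (h : Tree[ k ] n → K) → (∀ {x} → S x → ∑ x h ≈ 0#) →
               ∀ {x} → Span 𝕂 (component n) S x → ∑ x h ≈ 0#
    Span-∑≈0 h S≈0 (generator x∈S)       = S≈0 x∈S
    Span-∑≈0 h S≈0 (resp x≈y x∈)         = trans (sym (≋⇒extend h x≈y)) (Span-∑≈0 h S≈0 x∈)
    Span-∑≈0 h S≈0 zeroᴹ                 = refl
    Span-∑≈0 h S≈0 (plus {x} {y} x∈ y∈)  = trans (extend-++ 𝕂 h x y)
      (trans (+-cong (Span-∑≈0 h S≈0 x∈) (Span-∑≈0 h S≈0 y∈)) (+-identityˡ 0#))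
    Span-∑≈0 h S≈0 (scale l {x} x∈)      = trans (extend-scale 𝕂 h l x)
      (trans (*-congˡ (Span-∑≈0 h S≈0 x∈)) (zeroʳ l))

    -- The coefficient of `f` at `s` when `s` has the shape `left`, and its negative when `s` has
    -- the shape `right`.
    pairᵗ : Elt 2 → Tree k → K
    pairᵗ f s = ∑[ t ← f ] treePairing 𝕂 k (proj₁ t) s

    -- Every relator of Hi is such a binomial, so annihilating it means that two values of `pairᵗ f`
    -- agree.
    pairing-binomial : ∀ f x y z w →
      pairing 𝕂 k f (gen 𝕂 k x ∘[ zero ] gen 𝕂 k y -ᴹ gen 𝕂 k z ∘[ suc zero ] gen 𝕂 k w) ≈
      pairᵗ f (left x y) - pairᵗ f (right z w)
    pairing-binomial f x y z w = trans
      (∑-swap {h = λ t s → treePairing 𝕂 k (proj₁ t) (proj₁ s)} f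
        (gen 𝕂 k x ∘[ zero ] gen 𝕂 k y -ᴹ gen 𝕂 k z ∘[ suc zero ] gen 𝕂 k w))
      (+-cong
      (trans (*-congʳ (*-identityˡ 1#)) (*-identityˡ _))
      (trans (+-identityʳ _) (trans (*-congʳ (-‿cong (*-identityˡ 1#))) (-1*x≈-x _))))

    treePairing-left : ∀ x y x′ y′ → treePairing 𝕂 k (left x y) (left x′ y′) ≈ 𝟏 (x ≟ᶠ x′) * 𝟏 (y ≟ᶠ y′)
    treePairing-left x y x′ y′ with x ≟ᶠ x′
    ... | yes _ = sym (*-identityˡ _)
    ... | no  _ = sym (zeroˡ _)

    treePairing-right : ∀ x y x′ y′ → treePairing 𝕂 k (right x y) (right x′ y′) ≈ - (𝟏 (x ≟ᶠ x′) * 𝟏 (y ≟ᶠ y′))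
    treePairing-right x y x′ y′ with x ≟ᶠ x′ | y ≟ᶠ y′
    ... | yes _ | yes _ = -‿cong (sym (*-identityˡ _))
    ... | yes _ | no  _ = trans (sym -0#≈0#) (-‿cong (sym (*-identityˡ _)))
    ... | no  _ | _     = trans (sym -0#≈0#) (-‿cong (sym (zeroˡ _)))

    ∑-product : ∀ (g h : Fin k → K) u v → (∑[ x ← u ] ∑[ y ← v ] g x * h y) ≈ ∑ u g * ∑ v h
    ∑-product g h u v = trans (∑-cong u λ x → extend-* 𝕂 (g x) h v) (∑-*ʳ g (∑ v h) u)

    pairᵗ-bracket-left : ∀ u v x y → pairᵗ (bracket (spread u) (spread v)) (left x y) ≈
                         (∑[ x′ ← u ] 𝟏 (x′ ≟ᶠ x)) * (∑[ y′ ← v ] 𝟏 (y′ ≟ᶠ y))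
    pairᵗ-bracket-left u v x y = trans (∑-bracket-spread (λ t → treePairing 𝕂 k t (left x y)) u v) (trans
      (∑-cong u λ x′ → ∑-cong v λ y′ → trans (+-cong (treePairing-left x′ y′ x y) -0#≈0#) (+-identityʳ _))
      (∑-product _ _ u v))

    -- The sign of the pairing on right-shaped trees cancels the minus sign of the bracket, which
    -- yields the same product as `pairᵗ-bracket-left`.
    pairᵗ-bracket-right : ∀ u v x y → pairᵗ (bracket (spread u) (spread v)) (right y x) ≈
                          (∑[ x′ ← u ] 𝟏 (x′ ≟ᶠ x)) * (∑[ y′ ← v ] 𝟏 (y′ ≟ᶠ y))
    pairᵗ-bracket-right u v x y = trans (∑-bracket-spread (λ t → treePairing 𝕂 k t (right y x)) u v) (trans
      (∑-cong u λ x′ → ∑-cong v λ y′ → trans (+-identityˡ _)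
        (trans (-‿cong (treePairing-right y′ x′ y x)) (trans (-‿involutive _) (*-comm _ _))))
      (∑-product _ _ u v))

    -- Expansion in the basis of arity 3 with coordinates read from the pairing; the minus sign
    -- undoes the -1 of right-shaped trees. Trees of size 2 have only the two shapes below. The sum
    -- over `y` is outermost, as the later argument works with `y` fixed.
    expandᵗ : ∀ (h : Tree k → K) (t : Tree[ k ] 2) → h (proj₁ t) ≈
      (∑[ y ← full k ] ∑[ x ← full k ]
        treePairing 𝕂 k (proj₁ t) (left x y) * h (left x y) -
        treePairing 𝕂 k (proj₁ t) (right y x) * h (right y x))
    expandᵗ h (node x (node y leaf leaf) leaf , _) = sym (begin
      (∑[ y′ ← full k ] ∑[ x′ ← full k ]
        treePairing 𝕂 k (left x y) (left x′ y′) * h (left x′ y′) - 0# * h (right y′ x′))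
        ≈⟨ ∑-cong (full k) (λ y′ → ∑-cong (full k) λ x′ → trans
             (+-cong (trans (*-congʳ (trans (treePairing-left x y x′ y′) (*-comm _ _))) (*-assoc _ _ _))
                     (trans (-‿cong (zeroˡ _)) -0#≈0#))
             (+-identityʳ _)) ⟩
      (∑[ y′ ← full k ] ∑[ x′ ← full k ] 𝟏 (y ≟ᶠ y′) * (𝟏 (x ≟ᶠ x′) * h (left x′ y′)))
        ≈⟨ ∑-cong (full k) (λ y′ → trans (extend-* 𝕂 _ _ (full k))
             (*-congˡ (∑-full-𝟏 (λ x′ → h (left x′ y′)) x))) ⟩
      (∑[ y′ ← full k ] 𝟏 (y ≟ᶠ y′) * h (left x y′))
        ≈⟨ ∑-full-𝟏 (λ y′ → h (left x y′)) y ⟩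
      h (left x y) ∎)
    expandᵗ h (node y leaf (node x leaf leaf) , _) = sym (begin
      (∑[ y′ ← full k ] ∑[ x′ ← full k ]
        0# * h (left x′ y′) - treePairing 𝕂 k (right y x) (right y′ x′) * h (right y′ x′))
        ≈⟨ ∑-cong (full k) (λ y′ → ∑-cong (full k) λ x′ → trans
             (+-cong (zeroˡ _) (trans (-‿distribˡ-* _ _) (trans
               (*-congʳ (trans (-‿cong (treePairing-right y x y′ x′)) (-‿involutive _))) (*-assoc _ _ _))))
             (+-identityˡ _)) ⟩
      (∑[ y′ ← full k ] ∑[ x′ ← full k ] 𝟏 (y ≟ᶠ y′) * (𝟏 (x ≟ᶠ x′) * h (right y′ x′)))
        ≈⟨ ∑-cong (full k) (λ y′ → trans (extend-* 𝕂 _ _ (full k))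
             (*-congˡ (∑-full-𝟏 (λ x′ → h (right y′ x′)) x))) ⟩
      (∑[ y′ ← full k ] 𝟏 (y ≟ᶠ y′) * h (right y′ x))
        ≈⟨ ∑-full-𝟏 (λ y′ → h (right y′ x)) y ⟩
      h (right y x) ∎)

    ∑-expand : ∀ (h : Tree k → K) f → (∑[ t ← f ] h (proj₁ t)) ≈
      (∑[ y ← full k ] ∑[ x ← full k ] pairᵗ f (left x y) * h (left x y) - pairᵗ f (right y x) * h (right y x))
    ∑-expand h f = trans (∑-cong f (expandᵗ h)) (trans (∑-swap f (full k)) (∑-cong (full k) λ y →
      trans (∑-swap f (full k)) (∑-cong (full k) λ x →
        trans (∑-- _ _ f) (+-cong (∑-*ʳ _ _ f) (-‿cong (∑-*ʳ _ _ f))))))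

  -- Comparison of the two ideals

  module _ {c : ℕ} where

    private
      k = suc c
      γ = gen 𝕂 k
      -- The image of E⋆_x once the generator `b` stands for K⋆_b.
      D : Fin k → Operad.Elt (FreeOperad 𝕂 k) 1
      D x = spread (Δ x)

    open Operad (FreeOperad 𝕂 k)

    -- The relabelled relator is [K⋆_b , K⋆_a]. Its `pairᵗ` values at `left x y` and `right y x` are
    -- both the product of the brackets of `x ≤ b` and `y ≤ a`, which settles `above` at once and
    -- leaves a comparison for `below`.
    lower-relator : ∀ {x} → KRelator 𝕂 c x → Annihilator 𝕂 k (HiRelations 𝕂 c) (Relabelling.relabel lower x)
    lower-relator (relator {a} {b} a≤b) r r∈ = begin
      pairing 𝕂 k (Relabelling.relabel lower (bracket (γ b) (γ a))) r
        ≈⟨ FreeVectorSpace.≋⇒extend 𝕂 _≟_ _ (relabel-bracket lower b a) ⟩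
      pairing 𝕂 k f r
        ≈⟨ ∑-swap f r ⟩
      (∑[ s ← r ] pairᵗ f (proj₁ s))
        -- Pairing with `f` is linear, so vanishing on the spanning relators suffices.
        ≈⟨ Span-∑≈0 (λ s → pairᵗ f (proj₁ s)) (λ {r} r∈ → trans (sym (∑-swap f r)) (annihilates r∈)) r∈ ⟩
      0# ∎
      where
      f = bracket (spread (lower b)) (spread (lower a))

      pairᵗ-left : ∀ x y → pairᵗ f (left x y) ≈ 𝟏 (x ≤ᶠ? b) * 𝟏 (y ≤ᶠ? a)
      pairᵗ-left x y = trans (pairᵗ-bracket-left (lower b) (lower a) x y) (*-cong (lower⟨ b ⟩ x) (lower⟨ a ⟩ y))

      pairᵗ-right : ∀ x y → pairᵗ f (right y x) ≈ 𝟏 (x ≤ᶠ? b) * 𝟏 (y ≤ᶠ? a)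
      pairᵗ-right x y = trans (pairᵗ-bracket-right (lower b) (lower a) x y) (*-cong (lower⟨ b ⟩ x) (lower⟨ a ⟩ y))

      annihilates : ∀ {r} → HiRelator 𝕂 c r → pairing 𝕂 k f r ≈ 0#
      annihilates (above {x} {y} _) = trans (pairing-binomial f y x x y)
        (x≈y⇒x∙y⁻¹≈ε (trans (pairᵗ-left y x) (sym (pairᵗ-right y x))))
      annihilates (below {x} {x′} {y} x≤y x′≤y) = trans (pairing-binomial f x y y x′)
        (x≈y⇒x∙y⁻¹≈ε (trans (pairᵗ-left x y) (trans same (sym (pairᵗ-right x′ y)))))
        where
        -- If `y ≤ a`, then `x` and `x′` are at most `y ≤ a ≤ b`, so the first factors agree;
        -- otherwise both products vanish.
        same : 𝟏 (x ≤ᶠ? b) * 𝟏 (y ≤ᶠ? a) ≈ 𝟏 (x′ ≤ᶠ? b) * 𝟏 (y ≤ᶠ? a)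
        same with y ≤ᶠ? a
        ... | no  y≰a = trans (vanish x) (sym (vanish x′))
          where
          vanish : ∀ x → 𝟏 (x ≤ᶠ? b) * 𝟏 (y ≤ᶠ? a) ≈ 0#
          vanish x = trans (*-congˡ (𝟏-no (y ≤ᶠ? a) y≰a)) (zeroʳ _)
        ... | yes y≤a = *-congʳ (𝟏-cong (x ≤ᶠ? b) (x′ ≤ᶠ? b)
          (λ _ → ≤-trans x′≤y (≤-trans y≤a a≤b)) (λ _ → ≤-trans x≤y (≤-trans y≤a a≤b)))

    ⟨KRelator⟩ : Elt 2 → Set _
    ⟨KRelator⟩ = Generated 𝕂 (FreeOperad 𝕂 k) (KRelator 𝕂 c)

    bracket-mem : ∀ {u v} → All (λ (_ , x) → All (λ (_ , y) → y ≤ᶠ x) v) u →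
                  ⟨KRelator⟩ (bracket (spread u) (spread v))
    bracket-mem {u} {v} v≤u = ≈-mem (≈ᴹ-sym (bracket-spread u v))
      (>>=-mem (All.map (λ v≤x → >>=-mem (All.map (λ y≤x → generator (relator y≤x)) v≤x)) v≤u))

    bracket-last-mem : ∀ y → ⟨KRelator⟩ (bracket (γ (fromℕ c)) (D y))
    bracket-last-mem y = bracket-mem {[ 1# , fromℕ c ]} (All.universal (λ (_ , x) → ≤fromℕ x) (Δ y) ∷ [])

    -- As `y < x`, even the lower index `x - 1` in `Δ x` is at least `y`, hence at least every index
    -- in `Δ y`: all terms are multiples of relators.
    bracket-ΔΔ-mem : ∀ {x y} → y <ᶠ x → ⟨KRelator⟩ (bracket (D x) (D y))
    bracket-ΔΔ-mem {suc x} {y} y<x = bracket-mem {Δ (suc x)} {Δ y}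
      (All.map (λ y′≤y → ≤-trans y′≤y (<⇒≤ y<x)) (Δ-≤ y) ∷
       All.map (λ y′≤y → ≤-trans y′≤y (≤-trans (s≤s⁻¹ y<x) (≤-reflexive (≡-sym (toℕ-inject₁ x))))) (Δ-≤ y) ∷ [])

    ∑-bracket-ΔΔ : ∀ y → (full k >>= λ x → bracket (D x) (D y)) ≈ᴹ bracket (γ (fromℕ c)) (D y)
    ∑-bracket-ΔΔ y = ∑⇒≈ᴹ λ h →
      let g = λ x′ → ∑[ y′ ← Δ y ] h (left x′ y′) - h (right y′ x′) in begin
      _ ≈⟨ ∑->>= (full k) (λ x → bracket (D x) (D y)) ⟩
      _ ≈⟨ ∑-cong (full k) (λ x → ∑-bracket-spread h (Δ x) (Δ y)) ⟩
      -- The full sum is the partial sum up to the largest index, so its telescoping is an instance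
      -- of `lower-Δ`.
      (∑[ x ← full k ] ∑ (Δ x) g)             ≈⟨ ∑-lower-last (λ x → ∑ (Δ x) g) ⟨
      (∑[ x ← lower (fromℕ c) ] ∑ (Δ x) g)    ≈⟨ lower-Δ g (fromℕ c) ⟩
      g (fromℕ c)                             ≈⟨ extend-singleton 𝕂 g (fromℕ c) ⟨
      ∑ [ 1# , fromℕ c ] g                    ≈⟨ ∑-bracket-spread h [ 1# , fromℕ c ] (Δ y) ⟨
      _ ∎

    module _ {f : Elt 2} (f∈ : Annihilator 𝕂 k (HiRelations 𝕂 c) f) where

      -- The scalar κ x y of the overview.
      coeff : Fin k → Fin k → K
      coeff x y = pairᵗ f (left x y)

      coeff-below : ∀ {x x′ y} → x ≤ᶠ y → x′ ≤ᶠ y → coeff x y ≈ pairᵗ f (right y x′)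
      coeff-below x≤y x′≤y = x∙y⁻¹≈ε⇒x≈y _ _
        (trans (sym (pairing-binomial f _ _ _ _)) (f∈ _ (generator (below x≤y x′≤y))))

      coeff-above : ∀ {x y} → y <ᶠ x → coeff x y ≈ pairᵗ f (right y x)
      coeff-above y<x = x∙y⁻¹≈ε⇒x≈y _ _
        (trans (sym (pairing-binomial f _ _ _ _)) (f∈ _ (generator (above y<x))))

      coeff-right : ∀ x y → coeff x y ≈ pairᵗ f (right y x)
      coeff-right x y with x ≤ᶠ? y
      ... | yes x≤y = coeff-below x≤y x≤y
      ... | no  x≰y = coeff-above (≰⇒> x≰y)

      -- Both sides equal the value of `pairᵗ f` at `right y y`.
      coeff-const : ∀ {x y} → x ≤ᶠ y → coeff x y ≈ coeff y y
      coeff-const x≤y = trans (coeff-below x≤y ≤-refl) (sym (coeff-below ≤-refl ≤-refl))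

      -- By `coeff-right`, the coordinates of `f` at `left x y` and `right y x` are opposite, so
      -- they combine into a multiple of one bracket.
      annihilator-expand : f ≈ᴹ (full k >>= λ y → full k >>= λ x → coeff x y *ₗ bracket (γ x) (γ y))
      annihilator-expand = ∑⇒≈ᴹ λ h → begin
        _ ≈⟨ ∑-expand h f ⟩
        (∑[ y ← full k ] ∑[ x ← full k ] coeff x y * h (left x y) - pairᵗ f (right y x) * h (right y x))
          ≈⟨ ∑-cong (full k) (λ y → ∑-cong (full k) λ x → term h x y) ⟩
        (∑[ y ← full k ] ∑[ x ← full k ] ∑[ t ← coeff x y *ₗ bracket (γ x) (γ y) ] h (proj₁ t))
          ≈⟨ ∑-cong (full k) (λ y → ∑->>= {h = λ t → h (proj₁ t)} (full k)
               (λ x → coeff x y *ₗ bracket (γ x) (γ y))) ⟨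
        _ ≈⟨ ∑->>= (full k) (λ y → full k >>= λ x → coeff x y *ₗ bracket (γ x) (γ y)) ⟨
        _ ∎
        where
        term : ∀ h x y → coeff x y * h (left x y) - pairᵗ f (right y x) * h (right y x) ≈
                         (∑[ t ← coeff x y *ₗ bracket (γ x) (γ y) ] h (proj₁ t))
        term h x y = begin
          coeff x y * h (left x y) - pairᵗ f (right y x) * h (right y x)
            ≈⟨ +-congˡ (-‿cong (*-congʳ (coeff-right x y))) ⟨
          coeff x y * h (left x y) - coeff x y * h (right y x)
            ≈⟨ x[y-z]≈xy-xz _ _ _ ⟨
          coeff x y * (h (left x y) - h (right y x))
            ≈⟨ *-congˡ (extend-singleton 𝕂 (λ y → h (left x y) - h (right y x)) y) ⟨
          coeff x y * (∑[ y ← [ 1# , y ] ] h (left x y) - h (right y x))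
            ≈⟨ *-congˡ (extend-singleton 𝕂 (λ x → ∑[ y ← [ 1# , y ] ] h (left x y) - h (right y x)) x) ⟨
          coeff x y * (∑[ x ← [ 1# , x ] ] ∑[ y ← [ 1# , y ] ] h (left x y) - h (right y x))
            ≈⟨ *-congˡ (∑-bracket-spread h [ 1# , x ] [ 1# , y ]) ⟨
          coeff x y * (∑[ t ← bracket (γ x) (γ y) ] h (proj₁ t))
            ≈⟨ extend-scale 𝕂 (λ t → h (proj₁ t)) (coeff x y) (bracket (γ x) (γ y)) ⟨
          (∑[ t ← coeff x y *ₗ bracket (γ x) (γ y) ] h (proj₁ t)) ∎

      relabel-annihilator : Relabelling.relabel Δ f ≈ᴹ
        (full k >>= λ y → full k >>= λ x → coeff x y *ₗ bracket (D x) (D y))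
      relabel-annihilator = ≈ᴹ-trans (>>=-congˡ relabelᵍ annihilator-expand)
        (≈ᴹ-trans (>>=-assoc (full k) (λ y → full k >>= λ x → coeff x y *ₗ bracket (γ x) (γ y)) relabelᵍ)
          (>>=-congʳ (full k) λ y →
        ≈ᴹ-trans (>>=-assoc (full k) (λ x → coeff x y *ₗ bracket (γ x) (γ y)) relabelᵍ)
          (>>=-congʳ (full k) λ x →
        ≈ᴹ-trans (>>=-* (coeff x y) (bracket (γ x) (γ y)) relabelᵍ) (*ₗ-congˡ (relabel-bracket Δ x y)))))
        where open Relabelling Δ

      row-mem : ∀ y → ⟨KRelator⟩ (full k >>= λ x → coeff x y *ₗ bracket (D x) (D y))
      row-mem y = ≈-mem (≈ᴹ-sym split) (+-mem (>>=-mem (All.universal (λ (_ , x) → difference-mem x) (full k)))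
        (*-mem (coeff y y) (≈-mem (≈ᴹ-sym (∑-bracket-ΔΔ y)) (bracket-last-mem y))))
        where
        V : Fin k → Elt 2
        V x = bracket (D x) (D y)

        ∑-scaled : ∀ (h : Tree k → K) (κ : Fin k → K) →
          (∑[ t ← full k >>= (λ x → κ x *ₗ V x) ] h (proj₁ t)) ≈
          (∑[ x ← full k ] κ x * (∑[ t ← V x ] h (proj₁ t)))
        ∑-scaled h κ = trans (∑->>= (full k) (λ x → κ x *ₗ V x))
          (∑-cong (full k) λ x → extend-scale 𝕂 (λ t → h (proj₁ t)) (κ x) (V x))

        split : (full k >>= λ x → coeff x y *ₗ V x) ≈ᴹ
                (full k >>= λ x → (coeff x y - coeff y y) *ₗ V x) +ᴹ coeff y y *ₗ (full k >>= V)
        split = ∑⇒≈ᴹ λ h → begin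
          _ ≈⟨ ∑-scaled h (λ x → coeff x y) ⟩
          (∑[ x ← full k ] coeff x y * (∑[ t ← V x ] h (proj₁ t)))
            ≈⟨ ∑-cong (full k) (λ x → trans
                 (*-congʳ (sym (//-rightDividesˡ (coeff y y) (coeff x y)))) (distribʳ _ _ _)) ⟩
          (∑[ x ← full k ]
            (coeff x y - coeff y y) * (∑[ t ← V x ] h (proj₁ t)) + coeff y y * (∑[ t ← V x ] h (proj₁ t)))
            ≈⟨ extend-+ 𝕂 _ _ (full k) ⟩
          (∑[ x ← full k ] (coeff x y - coeff y y) * (∑[ t ← V x ] h (proj₁ t))) +
          (∑[ x ← full k ] coeff y y * (∑[ t ← V x ] h (proj₁ t)))
            ≈⟨ +-cong
                 (∑-scaled h (λ x → coeff x y - coeff y y))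
                 (trans (extend-scale 𝕂 _ (coeff y y) (full k >>= V)) (trans (*-congˡ (∑->>= (full k) V))
                   (sym (extend-* 𝕂 (coeff y y) _ (full k))))) ⟨
          _ ≈⟨ extend-++ 𝕂 _ (full k >>= λ x → (coeff x y - coeff y y) *ₗ V x) _ ⟨
          _ ∎

        -- The coefficient vanishes when `x ≤ y`, and the bracket itself lies in the ideal when
        -- `y < x`.
        difference-mem : ∀ x → ⟨KRelator⟩ ((coeff x y - coeff y y) *ₗ V x)
        difference-mem x with x ≤ᶠ? y
        ... | yes x≤y = ≈-mem (≈ᴹ-sym (≈ᴹ-trans (*ₗ-congʳ (x≈y⇒x∙y⁻¹≈ε (coeff-const x≤y)))
                                                (*ₗ-zeroˡ (V x)))) 0-mem
        ... | no  x≰y = *-mem (coeff x y - coeff y y) (bracket-ΔΔ-mem (≰⇒> x≰y))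

      relabel-annihilator-mem : ⟨KRelator⟩ (Relabelling.relabel Δ f)
      relabel-annihilator-mem = ≈-mem (≈ᴹ-sym relabel-annihilator)
        (>>=-mem (All.universal (λ (_ , y) → row-mem y) (full k)))

    -- The quotient keeps the carriers and operations of the free operad, so the sum defining `K⋆`
    -- is literally a concatenation of singletons.
    K⋆≡spread : ∀ b → K⋆ 𝕂 c b ≡ spread (lower b)
    K⋆≡spread b = go (filter (_≤ᶠ? b) (allFin k))
      where
      go : ∀ xs → foldr _++_ [] (map γ xs) ≡ spread (indicator xs)
      go []       = ≡-refl
      go (x ∷ xs) = cong (_ ∷_) (go xs)

    -- K⋆_b is the relabelling of the generator `b` by `lower`, which `Δ` undoes.
    relabel-K⋆ : ∀ b → Relabelling.relabel Δ (K⋆ 𝕂 c b) ≈ᴹ γ b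
    relabel-K⋆ b = subst (λ x → Relabelling.relabel Δ x ≈ᴹ γ b) (≡-sym (K⋆≡spread b))
      (≈ᴹ-trans (>>=-congˡ (Relabelling.relabelᵍ Δ) (≈ᴹ-sym (relabel-gen lower b)))
                (relabel-inverse {M = lower} {N = Δ} lower-Δ (γ b)))

proposition4p2p6 : ∀ {a ℓ₁ ℓ₂} (𝕂 : HeytingField a ℓ₁ ℓ₂) → CharacteristicZero 𝕂 → (c : ℕ) →
    Σ[ φ ∈ _≅_ 𝕂 (Hi! 𝕂 c) (KPresented 𝕂 c) ]
    ((b : Fin (suc c)) →
    Operad._≈ᴹ_ (KPresented 𝕂 c) (_≅_.to φ (K⋆ 𝕂 c b)) (gen 𝕂 (suc c) b))
proposition4p2p6 𝕂 _ c =
    -- The map substitutes K⋆_b - K⋆_{b-1} for E⋆_b, so the forward matrix is `Δ` and its inverse is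
    -- `lower`.
    relabel-≅ 𝕂 {M = Δ 𝕂} {N = lower 𝕂} (Δ-lower 𝕂) (lower-Δ 𝕂)
      (λ {f} f∈ → relabel-annihilator-mem 𝕂 {f = f} f∈)
      (λ x∈ → generator (lower-relator 𝕂 x∈))
  , λ b → ≈⇒Congruent 𝕂 (FreeOperad 𝕂 (suc c)) (⟨_⟩ 𝕂 (KRelator 𝕂 c)) (relabel-K⋆ 𝕂 b)
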